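{- Let $m\ge 1$ be an integer. Put $S(m)=\{ a(mn,k) \mid n\ge 1,\ k\ge 0\}$ and $R(m)=\{ c(mn,k) \mid n\ge 1,\ k\ge 0\}$. Then $S(m)=\mathbb{Z}$ and $R(m)=\mathbb{Z}$.
   Context: For $n\ge 1$, $\Phi_n(x)=\sum_{k=0}^{\varphi(n)} a(n,k)x^k$ denotes the $n$th cyclotomic polynomial, with $a(n,k)=0$ for $k>\varphi(n)$. The integers $c(n,k)$ are defined by the Taylor expansion around $x=0$: $\frac{1}{\Phi_n(x)}=\sum_{k=0}^{\infty} c(n,k)x^k$. -}

module Defs where

open import Data.Nat as ℕ using (ℕ; zero; suc)
open import Data.Nat.Divisibility using (_∣?_)
open import Data.Integer as ℤ using (ℤ; +_; -_; _+_; _*_)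
open import Data.List using (List; []; _∷_; [_]; _++_; map; reverse; replicate; length; foldr)
open import Relation.Nullary using (yes; no)
open import Data.Product using (_×_; _,_)

-- Polynomials with integer coefficients, as coefficient lists,
-- lowest degree first.
Poly : Set
Poly = List ℤ

padd : Poly → Poly → Poly
padd [] g = g
padd f [] = f
padd (a ∷ f) (b ∷ g) = (a + b) ∷ padd f g

pmul : Poly → Poly → Poly
pmul [] g = []
pmul (a ∷ f) g = padd (map (a *_) g) (+ 0 ∷ pmul f g)

coeff : Poly → ℕ → ℤ
coeff [] k = + 0
coeff (a ∷ f) zero = a
coeff (a ∷ f) (suc k) = coeff f k

-- Long division by a monic polynomial, on highest-degree-first lists.
-- gt = the divisor without its leading coefficient 1 (highest first),
-- q = number of quotient coefficients to produce.
divHF : ℕ → List ℤ → List ℤ → List ℤ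
divHF zero gt f = []
divHF (suc q) gt [] = []
divHF (suc q) gt (c ∷ f) = c ∷ divHF q gt (padd f (map (λ b → - (c * b)) gt))

pdivMonic : Poly → Poly → Poly
pdivMonic f g with reverse g
... | [] = []
... | (_ ∷ gt) = reverse (divHF (length f ℕ.∸ length g ℕ.+ 1) gt (reverse f))

xn-1 : ℕ → Poly
xn-1 zero = []
xn-1 (suc n) = - (+ 1) ∷ (replicate n (+ 0) ++ [ + 1 ])

prodDiv : ℕ → List (ℕ × Poly) → Poly
prodDiv N [] = + 1 ∷ []
prodDiv N ((d , p) ∷ t) with d ∣? N
... | yes _ = pmul p (prodDiv N t)
... | no _ = prodDiv N t

-- table n = [(1 , Φ_1) , … , (n , Φ_n)], defined by the classical recursion
-- Φ_N(x) = (x^N - 1) / ∏_{d ∣ N, d < N} Φ_d(x).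
table : ℕ → List (ℕ × Poly)
table zero = []
table (suc n) = let t = table n in
  t ++ [ (suc n , pdivMonic (xn-1 (suc n)) (prodDiv (suc n) t)) ]

-- Φ_n (for n ≥ 1); Φ_0 is an irrelevant dummy value.
lastPoly : List (ℕ × Poly) → Poly
lastPoly [] = + 1 ∷ []
lastPoly ((_ , p) ∷ []) = p
lastPoly (_ ∷ t@(_ ∷ _)) = lastPoly t

Φ : ℕ → Poly
Φ n = lastPoly (table n)

a : ℕ → ℕ → ℤ
a n k = coeff (Φ n) k

-- Taylor coefficients of 1/Φ_n at 0.  Since a(n,0) = ±1, a(n,0)⁻¹ = a(n,0),
-- and the coefficients are determined by Φ_n · (Σ c_k x^k) = 1:
--   c_0 = a_0,   c_k = a_0 · ( - Σ_{j=1}^{k} a_j c_{k-j} )  for k ≥ 1.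
-- cs n k = [c(n,k) , c(n,k-1) , … , c(n,0)]
convSum : ℕ → ℕ → List ℤ → ℤ
convSum n j [] = + 0
convSum n j (x ∷ xs) = a n j * x + convSum n (suc j) xs

cs : ℕ → ℕ → List ℤ
cs n zero = [ a n 0 ]
cs n (suc k) = let prev = cs n k in
  (a n 0 * - (convSum n 1 prev)) ∷ prev

headZ : List ℤ → ℤ
headZ [] = + 0
headZ (x ∷ _) = x

c : ℕ → ℕ → ℤ
c n k = headZ (cs n k)

{-# OPTIONS --safe #-}
module Submission where

-- Distinct Φ_d and Φ_e generate an ideal of ℤ[x] containing a nonzero integer, and both are
-- invertible as power series; hence the divisions defining Φ_n are exact and ∏_{d∣n} Φ_d = x^n - 1.
-- So, for a prime p, the series Φ_n(x^p) is Φ_np Φ_n or Φ_np according as p ∤ n or p ∣ n.  The second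
-- case reduces the theorem to squarefree m, which may also be taken with a(m,1) = 1.  Fix a large
-- prime q and put M = mq.  If p_1, …, p_t are primes in (P,2P] with t odd, then modulo x^(2P)
--     Φ_{M p_1 ⋯ p_t} = (1 - x^{p_1} - ⋯ - x^{p_t}) / Φ_M,
-- and if moreover the p_i lie in one residue class modulo M, then the periodicity of c(M,·) makes all
-- the summands c(M, k - p_i) of the coefficient of x^k equal.  Thanks to q the index k can be chosen
-- with c(M,k) = 0 and c(M, k - p_i) = 1, or -1, so that the coefficient is -t, or t.  Such clusters of
-- primes exist by Erdős's proof that ∑ 1/p diverges.  Finally c(nℓ,k) = a(n,k) for n > 1 and primes
-- ℓ > n, k, which also disposes of the parity condition on t.

-- Dirichlet's theorem is avoided. The Erdős count concerns all primes, and the pigeonhole principle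
-- then puts more than t of them into some class modulo M, with no say in which class. The index of
-- the wanted coefficient must therefore be found for whatever class turns up, and this is what q
-- buys: among the coefficients of 1/Φ_mq with indices from iq to iq + q - 1, only the first deg Φ_m
-- + 1 can be nonzero, so there is always an entry ±1 whose translate by p is 0. One prime of the
-- cluster, the largest, only fixes the index; the other t contribute one summand each. The
-- recursive definition of Φ by long division gives no information until the divisions are known to
-- be exact. Identities are therefore proved for formal power series over ℤ, where Φ_n has constant
-- term ±1 and can be cancelled. Polynomials are the series that vanish eventually; lists matter
-- only for showing that `pdivMonic` returns the expected quotient.

open import Defs
open import Algebra.Bundles using (CommutativeRing)
import Algebra.Solver.Ring as RingSolver
open import Algebra.Solver.Ring.AlmostCommutativeRing using (_-Raw-AlmostCommutative⟶_; fromCommutativeRing)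
open import Data.Empty using (⊥-elim)
open import Data.Fin using (Fin; toℕ)
import Data.Fin.Properties as Finₚ
open import Data.Integer as ℤ using (ℤ; +_; 0ℤ; 1ℤ; -1ℤ)
import Data.Integer.Properties as ℤₚ
open import Data.Integer.Tactic.RingSolver using (solve-∀)
open import Data.List using (List; []; _∷_; [_]; _++_; map; reverse; replicate; length; applyUpTo; filter; concatMap; applyDownFrom; upTo; take)
open import Data.List.Membership.Propositional using (_∈_; lose)
open import Data.List.Membership.Propositional.Properties using (∈-map⁺; ∈-concatMap⁺; ∈-upTo⁺; ∈-upTo⁻; ∈-filter⁺; ∈-++⁺ˡ; ∈-++⁺ʳ)
open import Data.List.Membership.Setoid.Properties using (index-injective)
import Data.List.Properties as Listₚ
open import Data.List.Relation.Unary.All as All using (All; []; _∷_)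
import Data.List.Relation.Unary.All.Properties as Allₚ
open import Data.List.Relation.Unary.AllPairs using (AllPairs; []; _∷_)
import Data.List.Relation.Unary.AllPairs.Properties as AllPairsₚ
open import Data.List.Relation.Unary.Any using (here; there; index)
import Data.List.Relation.Unary.Any.Properties as Anyₚ
import Data.Maybe as Maybe
open import Data.Nat using (ℕ; zero; suc; pred; _+_; _*_; _∸_; _^_; _⊔_; _≤_; _<_; _>_; _≥_; _≤?_; _<?_; z≤n; s≤s; NonZero; >-nonZero)
open import Data.Nat.Coprimality using (Coprime; coprime-divisor)
open import Data.Nat.Divisibility using (_∣_; _∤_; _∣?_; divides; ∣-refl; ∣-trans; ∣⇒≤; ∣m+n∣m⇒∣n; n∣m*n; m∣m*n; ∣m⇒∣m*n; *-monoˡ-∣; *-cancelʳ-∣; m%n≡0⇒n∣m)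
open import Data.Nat.DivMod using (_%_; _/_; m%n<n; m≡m%n+[m/n]*n)
open import Data.Nat.GCD using (gcd; gcd[m,n]∣m; gcd[m,n]∣n; gcd-GCD; module Bézout)
open import Data.Nat.ListAction using (product)
open import Data.Nat.Primality using (Prime; prime?; ¬prime[0]; ¬prime[1]; euclidsLemma; prime⇒irreducible; prime⇒nonZero)
open import Data.Nat.Primality.Factorisation using (factorise)
import Data.Nat.Properties as ℕₚ
open import Data.Nat.Tactic.RingSolver using () renaming (solve-∀ to solveℕ-∀)
open import Data.Product using (Σ; ∃; ∃₂; _×_; _,_; proj₂)
open import Data.Sum using (_⊎_; inj₁; inj₂)
open import Function using (_∘_)
open import Relation.Binary.Bundles using (Setoid)
open import Relation.Binary.PropositionalEquality using (_≡_; _≢_; refl; sym; trans; cong; cong₂; subst; setoid; module ≡-Reasoning)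
import Relation.Binary.Reasoning.Setoid as SetoidReasoning
open import Relation.Binary.Structures using (IsEquivalence)
open import Relation.Nullary using (¬_; Dec; yes; no)
open import Relation.Nullary.Decidable using (¬?; _×-dec_; dec⇒maybe)

-- Formal power series over ℤ

Series : Set
Series = ℕ → ℤ

tail : Series → Series
tail f k = f (suc k)

infix 4 _≈_ _≈[_]_
infixl 6 _⊕_
infixl 7 _⊙_
infix 8 ⊖_

-- A record and not a bare function type, so that unification can recover the two series from a
-- proof.
record _≈_ (f g : Series) : Set where
  constructor pointwise
  field at : ∀ k → f k ≡ g k
open _≈_

-- Congruence modulo x^L.
record _≈[_]_ (f : Series) (L : ℕ) (g : Series) : Set where
  constructor pointwise<
  field at< : ∀ k → k < L → f k ≡ g k
open _≈[_]_

𝟘 : Series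
𝟘 k = 0ℤ

const : ℤ → Series
const x zero    = x
const x (suc k) = 0ℤ

𝟙 : Series
𝟙 = const 1ℤ

_⊕_ : Series → Series → Series
(f ⊕ g) k = f k ℤ.+ g k

⊖_ : Series → Series
(⊖ f) k = ℤ.- f k

-- The Cauchy product, read off from f = f(0) + x·`tail f`. No finite sums occur, and the ring laws
-- become inductions on the index.
_⊙_ : Series → Series → Series
(f ⊙ g) zero    = f 0 ℤ.* g 0
(f ⊙ g) (suc k) = f 0 ℤ.* g (suc k) ℤ.+ (tail f ⊙ g) k

X^ : ℕ → Series
X^ zero            = 𝟙
X^ (suc n) zero    = 0ℤ
X^ (suc n) (suc k) = X^ n k

≈-isEquivalence : IsEquivalence _≈_
≈-isEquivalence = record
  { refl  = pointwise λ _ → refl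
  ; sym   = λ e → pointwise λ k → sym (at e k)
  ; trans = λ e e′ → pointwise λ k → trans (at e k) (at e′ k)
  }

≈[]-isEquivalence : ∀ L → IsEquivalence _≈[ L ]_
≈[]-isEquivalence L = record
  { refl  = pointwise< λ _ _ → refl
  ; sym   = λ e → pointwise< λ k l → sym (at< e k l)
  ; trans = λ e e′ → pointwise< λ k l → trans (at< e k l) (at< e′ k l)
  }

≈[]-setoid : ℕ → Setoid _ _
≈[]-setoid L = record { isEquivalence = ≈[]-isEquivalence L }

≈⇒≈[] : ∀ {f g} L → f ≈ g → f ≈[ L ] g
≈⇒≈[] L e = pointwise< λ k _ → at e k

⊙-local : ∀ f f′ g g′ k → (∀ j → j ≤ k → f j ≡ f′ j) → (∀ j → j ≤ k → g j ≡ g′ j) →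
          (f ⊙ g) k ≡ (f′ ⊙ g′) k
⊙-local f f′ g g′ zero    p q = cong₂ ℤ._*_ (p 0 z≤n) (q 0 z≤n)
⊙-local f f′ g g′ (suc k) p q = cong₂ ℤ._+_
  (cong₂ ℤ._*_ (p 0 z≤n) (q (suc k) ℕₚ.≤-refl))
  (⊙-local (tail f) (tail f′) g g′ k (λ j l → p (suc j) (s≤s l)) (λ j l → q j (ℕₚ.m≤n⇒m≤1+n l)))

⊙-cong : ∀ {f f′ g g′} → f ≈ f′ → g ≈ g′ → f ⊙ g ≈ f′ ⊙ g′
⊙-cong {f} {f′} {g} {g′} e e′ = pointwise λ k → ⊙-local f f′ g g′ k (λ j _ → at e j) (λ j _ → at e′ j)

⊙-cong< : ∀ {L f f′ g g′} → f ≈[ L ] f′ → g ≈[ L ] g′ → f ⊙ g ≈[ L ] f′ ⊙ g′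
⊙-cong< {L} {f} {f′} {g} {g′} e e′ = pointwise< λ k l → ⊙-local f f′ g g′ k
  (λ j j≤k → at< e j (ℕₚ.≤-<-trans j≤k l)) (λ j j≤k → at< e′ j (ℕₚ.≤-<-trans j≤k l))

⊙-suc : ∀ f g k → (f ⊙ g) (suc k) ≡ (f ⊙ tail g) k ℤ.+ f (suc k) ℤ.* g 0
⊙-suc f g zero    = refl
⊙-suc f g (suc k) = trans (cong (ℤ._+_ (f 0 ℤ.* g (2 + k))) (⊙-suc (tail f) g k))
  (sym (ℤₚ.+-assoc (f 0 ℤ.* g (2 + k)) _ _))

⊙-comm : ∀ f g → f ⊙ g ≈ g ⊙ f
⊙-comm f g = pointwise (go f g)
  where
  go : ∀ f g k → (f ⊙ g) k ≡ (g ⊙ f) k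
  go f g zero    = ℤₚ.*-comm (f 0) (g 0)
  go f g (suc k) = begin
    f 0 ℤ.* g (suc k) ℤ.+ (tail f ⊙ g) k  ≡⟨ cong₂ ℤ._+_ (ℤₚ.*-comm (f 0) _) (go (tail f) g k) ⟩
    g (suc k) ℤ.* f 0 ℤ.+ (g ⊙ tail f) k  ≡⟨ ℤₚ.+-comm (g (suc k) ℤ.* f 0) _ ⟩
    (g ⊙ tail f) k ℤ.+ g (suc k) ℤ.* f 0  ≡⟨ ⊙-suc g f k ⟨
    (g ⊙ f) (suc k)                       ∎
    where open ≡-Reasoning

⊙-distribʳ : ∀ h f g → (f ⊕ g) ⊙ h ≈ f ⊙ h ⊕ g ⊙ h
⊙-distribʳ h f g = pointwise (go f g)
  where
  interchange : ∀ a b c x y → (a ℤ.+ b) ℤ.* c ℤ.+ (x ℤ.+ y) ≡ a ℤ.* c ℤ.+ x ℤ.+ (b ℤ.* c ℤ.+ y)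
  interchange = solve-∀
  go : ∀ f g k → ((f ⊕ g) ⊙ h) k ≡ (f ⊙ h ⊕ g ⊙ h) k
  go f g zero    = ℤₚ.*-distribʳ-+ (h 0) (f 0) (g 0)
  go f g (suc k) = trans (cong (ℤ._+_ ((f 0 ℤ.+ g 0) ℤ.* h (suc k))) (go (tail f) (tail g) k))
    (interchange (f 0) (g 0) (h (suc k)) _ _)

scale : ℤ → Series → Series
scale x f k = x ℤ.* f k

scale-⊙ : ∀ x f g → scale x f ⊙ g ≈ scale x (f ⊙ g)
scale-⊙ x f g = pointwise (go f)
  where
  go : ∀ f k → (scale x f ⊙ g) k ≡ x ℤ.* (f ⊙ g) k
  go f zero    = ℤₚ.*-assoc x (f 0) (g 0)
  go f (suc k) = trans (cong₂ ℤ._+_ (ℤₚ.*-assoc x (f 0) (g (suc k))) (go (tail f) k))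
    (sym (ℤₚ.*-distribˡ-+ x _ _))

⊙-zeroˡ : ∀ f → 𝟘 ⊙ f ≈ 𝟘
⊙-zeroˡ f = pointwise go
  where
  go : ∀ k → (𝟘 ⊙ f) k ≡ 0ℤ
  go zero    = ℤₚ.*-zeroˡ (f 0)
  go (suc k) = cong₂ ℤ._+_ (ℤₚ.*-zeroˡ (f (suc k))) (go k)

const-⊙ : ∀ x f → const x ⊙ f ≈ scale x f
const-⊙ x f = pointwise λ where
  zero    → refl
  (suc k) → trans (cong (ℤ._+_ (x ℤ.* f (suc k))) (at (⊙-zeroˡ f) k)) (ℤₚ.+-identityʳ _)

⊙-identityˡ : ∀ f → 𝟙 ⊙ f ≈ f
⊙-identityˡ f = pointwise λ k → trans (at (const-⊙ 1ℤ f) k) (ℤₚ.*-identityˡ (f k))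

⊙-assoc : ∀ f g h → (f ⊙ g) ⊙ h ≈ f ⊙ (g ⊙ h)
⊙-assoc f g h = pointwise (go f)
  where
  open ≡-Reasoning
  go : ∀ f k → ((f ⊙ g) ⊙ h) k ≡ (f ⊙ (g ⊙ h)) k
  go f zero    = ℤₚ.*-assoc (f 0) (g 0) (h 0)
  go f (suc k) = begin
    f 0 ℤ.* g 0 ℤ.* h (suc k) ℤ.+ ((scale (f 0) (tail g) ⊕ tail f ⊙ g) ⊙ h) k
      ≡⟨ cong (ℤ._+_ (f 0 ℤ.* g 0 ℤ.* h (suc k))) (at (⊙-distribʳ h (scale (f 0) (tail g)) (tail f ⊙ g)) k) ⟩
    f 0 ℤ.* g 0 ℤ.* h (suc k) ℤ.+ ((scale (f 0) (tail g) ⊙ h) k ℤ.+ ((tail f ⊙ g) ⊙ h) k)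
      ≡⟨ ℤₚ.+-assoc (f 0 ℤ.* g 0 ℤ.* h (suc k)) _ _ ⟨
    f 0 ℤ.* g 0 ℤ.* h (suc k) ℤ.+ (scale (f 0) (tail g) ⊙ h) k ℤ.+ ((tail f ⊙ g) ⊙ h) k
      ≡⟨ cong₂ ℤ._+_
           (trans (cong₂ ℤ._+_ (ℤₚ.*-assoc (f 0) (g 0) (h (suc k))) (at (scale-⊙ (f 0) (tail g) h) k))
                  (sym (ℤₚ.*-distribˡ-+ (f 0) _ _)))
           (go (tail f) k) ⟩
    f 0 ℤ.* (g ⊙ h) (suc k) ℤ.+ (tail f ⊙ (g ⊙ h)) k ∎

⊕-cong : ∀ {f f′ g g′} → f ≈ f′ → g ≈ g′ → f ⊕ g ≈ f′ ⊕ g′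
⊕-cong e e′ = pointwise λ k → cong₂ ℤ._+_ (at e k) (at e′ k)

⊖-cong : ∀ {f g} → f ≈ g → ⊖ f ≈ ⊖ g
⊖-cong e = pointwise λ k → cong ℤ.-_ (at e k)

open IsEquivalence ≈-isEquivalence
  using () renaming (refl to ≈-refl; sym to ≈-sym; trans to ≈-trans)

≈-reflexive : ∀ {f g} → f ≡ g → f ≈ g
≈-reflexive refl = ≈-refl

series-ring : CommutativeRing _ _
series-ring = record
  { Carrier = Series ; _≈_ = _≈_ ; _+_ = _⊕_ ; _*_ = _⊙_ ; -_ = ⊖_ ; 0# = 𝟘 ; 1# = 𝟙
  ; isCommutativeRing = record
    { isRing = record
      { +-isAbelianGroup = record
        { isGroup = record
          { isMonoid = record
            { isSemigroup = record
              { isMagma = record { isEquivalence = ≈-isEquivalence ; ∙-cong = ⊕-cong }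
              ; assoc = λ f g h → pointwise λ k → ℤₚ.+-assoc (f k) (g k) (h k)
              }
            ; identity = (λ f → pointwise λ k → ℤₚ.+-identityˡ (f k))
                       , (λ f → pointwise λ k → ℤₚ.+-identityʳ (f k))
            }
          ; inverse = (λ f → pointwise λ k → ℤₚ.+-inverseˡ (f k))
                    , (λ f → pointwise λ k → ℤₚ.+-inverseʳ (f k))
          ; ⁻¹-cong = ⊖-cong
          }
        ; comm = λ f g → pointwise λ k → ℤₚ.+-comm (f k) (g k)
        }
      ; *-cong = ⊙-cong
      ; *-assoc = ⊙-assoc
      ; *-identity = ⊙-identityˡ , λ f → ≈-trans (⊙-comm f 𝟙) (⊙-identityˡ f)
      ; distrib = (λ f g h → ≈-trans (⊙-comm f (g ⊕ h))
                     (≈-trans (⊙-distribʳ f g h) (⊕-cong (⊙-comm g f) (⊙-comm h f))))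
                , ⊙-distribʳ
      }
    ; *-comm = ⊙-comm
    }
  }

module ≈-Reasoning = SetoidReasoning (CommutativeRing.setoid series-ring)
module ≈[]-Reasoning (L : ℕ) = SetoidReasoning (≈[]-setoid L)

const-+ : ∀ x y → const (x ℤ.+ y) ≈ const x ⊕ const y
const-+ x y = pointwise λ { zero → refl ; (suc k) → refl }

const-* : ∀ x y → const (x ℤ.* y) ≈ const x ⊙ const y
const-* x y = ≈-trans (pointwise λ { zero → refl ; (suc k) → sym (ℤₚ.*-zeroʳ x) }) (≈-sym (const-⊙ x (const y)))

-- Lets the ring solver calculate with integer coefficients: equality of constants is decidable
-- although `_≈_` is not.
const-homomorphism : ℤ.+-*-rawRing -Raw-AlmostCommutative⟶ fromCommutativeRing series-ring
const-homomorphism = record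
  { ⟦_⟧    = const
  ; +-homo = const-+
  ; *-homo = const-*
  ; -‿homo = λ x → pointwise λ { zero → refl ; (suc k) → refl }
  ; 0-homo = pointwise λ { zero → refl ; (suc k) → refl }
  ; 1-homo = ≈-refl
  }

const-≟ : ∀ x y → Maybe.Maybe (const x ≈ const y)
const-≟ x y = Maybe.map (λ { refl → ≈-refl }) (dec⇒maybe (x ℤ.≟ y))

module Solver = RingSolver ℤ.+-*-rawRing (fromCommutativeRing series-ring) const-homomorphism const-≟
open Solver using (solve; _:+_; _:*_; :-_; _:-_; _:=_; con)

-- Units and division of power series

IsUnit : Series → Set
IsUnit f = f 0 ℤ.* f 0 ≡ 1ℤ

-- Division in ascending powers: subtract h(0)f(0)·h from f and divide by x, as `divHF` does on
-- lists. It is f/h when h is a unit, because then h(0) is its own inverse.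
quot : Series → Series → Series
quot h f zero    = h 0 ℤ.* f 0
quot h f (suc k) = quot h (tail f ⊕ ⊖ scale (h 0 ℤ.* f 0) (tail h)) k

quot-⊙ : ∀ h f → IsUnit h → quot h f ⊙ h ≈ f
quot-⊙ h f u = pointwise (go f)
  where
  shuffle : ∀ x y → x ℤ.* y ℤ.* x ≡ x ℤ.* x ℤ.* y
  shuffle = solve-∀
  cancel : ∀ x y → x ℤ.+ (y ℤ.+ ℤ.- x) ≡ y
  cancel = solve-∀
  go : ∀ f k → (quot h f ⊙ h) k ≡ f k
  go f zero    = trans (shuffle (h 0) (f 0)) (trans (cong (ℤ._* f 0) u) (ℤₚ.*-identityˡ (f 0)))
  go f (suc k) = trans (cong (ℤ._+_ (h 0 ℤ.* f 0 ℤ.* h (suc k))) (go _ k))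
    (cancel (h 0 ℤ.* f 0 ℤ.* h (suc k)) (f (suc k)))

⊙-cancelʳ : ∀ h {f g} → IsUnit h → f ⊙ h ≈ g ⊙ h → f ≈ g
⊙-cancelʳ h {f} {g} u e = begin
  f            ≈⟨ expand f ⟩
  (f ⊙ h) ⊙ i  ≈⟨ ⊙-cong e ≈-refl ⟩
  (g ⊙ h) ⊙ i  ≈⟨ expand g ⟨
  g            ∎
  where
  open ≈-Reasoning
  i = quot h 𝟙
  expand : ∀ f → f ≈ (f ⊙ h) ⊙ i
  expand f = begin
    f            ≈⟨ ⊙-identityˡ f ⟨
    𝟙 ⊙ f        ≈⟨ ⊙-cong (quot-⊙ h 𝟙 u) ≈-refl ⟨
    (i ⊙ h) ⊙ f  ≈⟨ solve 3 (λ i h f → (i :* h) :* f := (f :* h) :* i) ≈-refl i h f ⟩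
    (f ⊙ h) ⊙ i  ∎

unit-𝟙 : IsUnit 𝟙
unit-𝟙 = refl

unit-⊙ : ∀ f g → IsUnit f → IsUnit g → IsUnit (f ⊙ g)
unit-⊙ f g u v = trans (interchange (f 0) (g 0)) (cong₂ ℤ._*_ u v)
  where
  interchange : ∀ x y → x ℤ.* y ℤ.* (x ℤ.* y) ≡ x ℤ.* x ℤ.* (y ℤ.* y)
  interchange = solve-∀

unit-resp-≈ : ∀ {f g} → f ≈ g → IsUnit f → IsUnit g
unit-resp-≈ e u = trans (cong₂ ℤ._*_ (sym (at e 0)) (sym (at e 0))) u

-- f(0) divides the square of (fg)(0), which is 1.
unit-factorˡ : ∀ f g → IsUnit (f ⊙ g) → IsUnit f
unit-factorˡ f g u = square (f 0) (ℕₚ.m*n≡1⇒m≡1 ℤ.∣ f 0 ∣ ℤ.∣ f 0 ℤ.* (g 0 ℤ.* g 0) ∣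
  (trans (sym (ℤₚ.∣i*j∣≡∣i∣*∣j∣ (f 0) _)) (cong ℤ.∣_∣ (trans (regroup (f 0) (g 0)) u))))
  where
  regroup : ∀ x y → x ℤ.* (x ℤ.* (y ℤ.* y)) ≡ x ℤ.* y ℤ.* (x ℤ.* y)
  regroup = solve-∀
  square : ∀ x → ℤ.∣ x ∣ ≡ 1 → x ℤ.* x ≡ 1ℤ
  square (+ 1)       refl = refl
  square (ℤ.-[1+ 0 ]) refl = refl

-- Supports and degrees

VanishesFrom : ℕ → Series → Set
VanishesFrom K f = ∀ k → K ≤ k → f k ≡ 0ℤ

Finite : Series → Set
Finite f = ∃ λ K → VanishesFrom K f

-- The off-by-one is the sharp one: degrees at most d - 1 and e - 1 add up to at most d + e - 2.
⊙-vanishes : ∀ d e {f g} → VanishesFrom d f → VanishesFrom e g → ∀ k → d + e ≤ suc k → (f ⊙ g) k ≡ 0ℤ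
⊙-vanishes zero e {f} {g} p q k l =
  trans (at (⊙-cong {f} {𝟘} (pointwise λ j → p j z≤n) (≈-refl {g})) k) (at (⊙-zeroˡ g) k)
⊙-vanishes (suc d) e {f} {g} p q zero (s≤s l) =
  trans (cong (f 0 ℤ.*_) (q 0 (ℕₚ.≤-trans (ℕₚ.m≤n+m e d) l))) (ℤₚ.*-zeroʳ (f 0))
⊙-vanishes (suc d) e {f} {g} p q (suc k) (s≤s l) = cong₂ ℤ._+_
  (trans (cong (f 0 ℤ.*_) (q (suc k) (ℕₚ.≤-trans (ℕₚ.m≤n+m e d) l))) (ℤₚ.*-zeroʳ (f 0)))
  (⊙-vanishes d e (λ j m → p (suc j) (s≤s m)) q k l)

⊙-top : ∀ d e {f g} → VanishesFrom (suc d) f → VanishesFrom (suc e) g → (f ⊙ g) (d + e) ≡ f d ℤ.* g e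
⊙-top zero e {f} {g} p q =
  trans (at (⊙-cong {f} {const (f 0)} (pointwise λ { zero → refl ; (suc j) → p (suc j) (s≤s z≤n) }) (≈-refl {g})) e)
        (at (const-⊙ (f 0) g) e)
⊙-top (suc d) e {f} {g} p q = trans
  (cong₂ ℤ._+_ (trans (cong (f 0 ℤ.*_) (q (suc (d + e)) (s≤s (ℕₚ.m≤n+m e d)))) (ℤₚ.*-zeroʳ (f 0)))
               (⊙-top d e (λ j m → p (suc j) (s≤s m)) q))
  (ℤₚ.+-identityˡ _)

finite-const : ∀ x → Finite (const x)
finite-const x = 1 , λ { (suc k) _ → refl }

finite-X^ : ∀ n → Finite (X^ n)
finite-X^ n = suc n , go n
  where
  go : ∀ n → VanishesFrom (suc n) (X^ n)
  go zero    (suc k) _       = refl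
  go (suc n) (suc k) (s≤s l) = go n k l

finite-⊕ : ∀ {f g} → Finite f → Finite g → Finite (f ⊕ g)
finite-⊕ (K , p) (L , q) = K ⊔ L , λ k l → cong₂ ℤ._+_
  (p k (ℕₚ.≤-trans (ℕₚ.m≤m⊔n K L) l)) (q k (ℕₚ.≤-trans (ℕₚ.m≤n⊔m K L) l))

finite-⊖ : ∀ {f} → Finite f → Finite (⊖ f)
finite-⊖ (K , p) = K , λ k l → cong ℤ.-_ (p k l)

finite-⊙ : ∀ {f g} → Finite f → Finite g → Finite (f ⊙ g)
finite-⊙ (K , p) (L , q) = K + L , λ k l → ⊙-vanishes K L p q k (ℕₚ.m≤n⇒m≤1+n l)

finite-resp-≈ : ∀ {f g} → f ≈ g → Finite f → Finite g
finite-resp-≈ e (K , p) = K , λ k l → trans (sym (at e k)) (p k l)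

finite-unscale : ∀ {D f} → D ≢ 0ℤ → Finite (const D ⊙ f) → Finite f
finite-unscale {D} {f} D≢0 (K , p) = K , λ k l → nonzero (ℤₚ.i*j≡0⇒i≡0∨j≡0 D (trans (sym (at (const-⊙ D f) k)) (p k l)))
  where
  nonzero : ∀ {x} → D ≡ 0ℤ ⊎ x ≡ 0ℤ → x ≡ 0ℤ
  nonzero (inj₁ D≡0) = ⊥-elim (D≢0 D≡0)
  nonzero (inj₂ x≡0) = x≡0

-- The polynomials x^n and x^n - 1

X^-⊙-+ : ∀ n f k → (X^ n ⊙ f) (n + k) ≡ f k
X^-⊙-+ zero    f k = at (⊙-identityˡ f) k
X^-⊙-+ (suc n) f k = trans (cong₂ ℤ._+_ (ℤₚ.*-zeroˡ (f (suc (n + k)))) (X^-⊙-+ n f k)) (ℤₚ.+-identityˡ (f k))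

X^-⊙-< : ∀ n f k → k < n → (X^ n ⊙ f) k ≡ 0ℤ
X^-⊙-< (suc n) f zero    l       = ℤₚ.*-zeroˡ (f 0)
X^-⊙-< (suc n) f (suc k) (s≤s l) = cong₂ ℤ._+_ (ℤₚ.*-zeroˡ (f (suc k))) (X^-⊙-< n f k l)

X^-+ : ∀ m n → X^ m ⊙ X^ n ≈ X^ (m + n)
X^-+ zero    n = ⊙-identityˡ (X^ n)
X^-+ (suc m) n = pointwise λ where
  zero    → ℤₚ.*-zeroˡ (X^ n 0)
  (suc k) → trans (cong₂ ℤ._+_ (ℤₚ.*-zeroˡ (X^ n (suc k))) (at (X^-+ m n) k)) (ℤₚ.+-identityˡ _)

X^-≡ : ∀ n → X^ n n ≡ 1ℤ
X^-≡ zero    = refl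
X^-≡ (suc n) = X^-≡ n

X^-≢ : ∀ n k → k ≢ n → X^ n k ≡ 0ℤ
X^-≢ zero    zero    ne = ⊥-elim (ne refl)
X^-≢ zero    (suc k) ne = refl
X^-≢ (suc n) zero    ne = refl
X^-≢ (suc n) (suc k) ne = X^-≢ n k (λ e → ne (cong suc e))

X^-1 : ℕ → Series
X^-1 n = X^ n ⊕ ⊖ 𝟙

X^-1-top : ∀ n → 1 ≤ n → X^-1 n n ≡ 1ℤ
X^-1-top n 1≤n = cong₂ (λ x y → x ℤ.+ ℤ.- y) (X^-≡ n) (X^-≢ 0 n (λ { refl → ℕₚ.1+n≰n 1≤n }))

unit-X^-1 : ∀ n → 1 ≤ n → IsUnit (X^-1 n)
unit-X^-1 (suc n) _ = refl

finite-X^-1 : ∀ n → Finite (X^-1 n)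
finite-X^-1 n = finite-⊕ (finite-X^ n) (finite-⊖ (finite-const 1ℤ))

X^-1-+ : ∀ m n → X^-1 (m + n) ≈ X^ m ⊙ X^-1 n ⊕ X^-1 m
X^-1-+ m n = begin
  X^ (m + n) ⊕ ⊖ 𝟙     ≈⟨ ⊕-cong (X^-+ m n) ≈-refl ⟨
  X^ m ⊙ X^ n ⊕ ⊖ 𝟙    ≈⟨ solve 2 (λ x y → x :* y :+ (:- con 1ℤ) := x :* (y :+ (:- con 1ℤ)) :+ (x :+ (:- con 1ℤ)))
                             ≈-refl (X^ m) (X^ n) ⟩
  X^ m ⊙ X^-1 n ⊕ X^-1 m ∎
  where open ≈-Reasoning

-- 1 + x^g + ... + x^((m-1)g), in Horner form.
geometric : ℕ → ℕ → Series
geometric g zero    = 𝟘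
geometric g (suc m) = 𝟙 ⊕ X^ g ⊙ geometric g m

finite-geometric : ∀ g m → Finite (geometric g m)
finite-geometric g zero    = 0 , λ _ _ → refl
finite-geometric g (suc m) = finite-⊕ (finite-const 1ℤ) (finite-⊙ (finite-X^ g) (finite-geometric g m))

geometric-⊙ : ∀ g m → geometric g m ⊙ X^-1 g ≈ X^-1 (m * g)
geometric-⊙ g zero = begin
  𝟘 ⊙ X^-1 g  ≈⟨ ⊙-zeroˡ (X^-1 g) ⟩
  𝟘           ≈⟨ pointwise (λ { zero → refl ; (suc k) → refl }) ⟩
  𝟙 ⊕ ⊖ 𝟙     ∎
  where open ≈-Reasoning
geometric-⊙ g (suc m) = begin
  (𝟙 ⊕ X^ g ⊙ s) ⊙ X^-1 g         ≈⟨ solve 3 (λ x s q → (con 1ℤ :+ x :* s) :* q := x :* (s :* q) :+ q)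
                                       ≈-refl (X^ g) s (X^-1 g) ⟩
  X^ g ⊙ (s ⊙ X^-1 g) ⊕ X^-1 g    ≈⟨ ⊕-cong (⊙-cong ≈-refl (geometric-⊙ g m)) ≈-refl ⟩
  X^ g ⊙ X^-1 (m * g) ⊕ X^-1 g    ≈⟨ X^-1-+ g (m * g) ⟨
  X^-1 (g + m * g)                ∎
  where
  open ≈-Reasoning
  s = geometric g m

-- Modulo x^g - 1 each of the m powers of x^g is 1. The m obtained here is the nonzero integer in
-- the comaximality of two cyclotomic polynomials.
geometric-remainder : ∀ g m → ∃ λ T → Finite T × geometric g m ≈ const (+ m) ⊕ T ⊙ X^-1 g
geometric-remainder g zero = 𝟘 , (0 , λ _ _ → refl) ,
  pointwise λ { zero    → sym (trans (ℤₚ.+-identityˡ _) (at (⊙-zeroˡ (X^-1 g)) 0))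
              ; (suc k) → sym (trans (ℤₚ.+-identityˡ _) (at (⊙-zeroˡ (X^-1 g)) (suc k))) }
geometric-remainder g (suc m) with geometric-remainder g m
... | T , fin , e = T ⊕ geometric g m , finite-⊕ fin (finite-geometric g m) , (begin
  𝟙 ⊕ X^ g ⊙ s                            ≈⟨ solve 2 (λ x s → con 1ℤ :+ x :* s := con 1ℤ :+ s :+ s :* (x :- con 1ℤ))
                                               ≈-refl (X^ g) s ⟩
  𝟙 ⊕ s ⊕ s ⊙ q                           ≈⟨ ⊕-cong (⊕-cong (≈-refl {𝟙}) e) ≈-refl ⟩
  𝟙 ⊕ (const (+ m) ⊕ T ⊙ q) ⊕ s ⊙ q       ≈⟨ solve 4 (λ n t s q → con 1ℤ :+ (n :+ t :* q) :+ s :* q := (con 1ℤ :+ n) :+ (t :+ s) :* q)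
                                               ≈-refl (const (+ m)) T s q ⟩
  (𝟙 ⊕ const (+ m)) ⊕ (T ⊕ s) ⊙ q         ≈⟨ ⊕-cong (const-+ 1ℤ (+ m)) ≈-refl ⟨
  const (+ suc m) ⊕ (T ⊕ s) ⊙ q           ∎)
  where
  open ≈-Reasoning
  s = geometric g m
  q = X^-1 g

-- Coefficient lists and long division

coeff-padd : ∀ f g k → coeff (padd f g) k ≡ coeff f k ℤ.+ coeff g k
coeff-padd []      g       k       = sym (ℤₚ.+-identityˡ _)
coeff-padd (x ∷ f) []      k       = sym (ℤₚ.+-identityʳ _)
coeff-padd (x ∷ f) (y ∷ g) zero    = refl
coeff-padd (x ∷ f) (y ∷ g) (suc k) = coeff-padd f g k

coeff-map : ∀ (φ : ℤ → ℤ) → φ 0ℤ ≡ 0ℤ → ∀ f k → coeff (map φ f) k ≡ φ (coeff f k)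
coeff-map φ φ0 []      k       = sym φ0
coeff-map φ φ0 (x ∷ f) zero    = refl
coeff-map φ φ0 (x ∷ f) (suc k) = coeff-map φ φ0 f k

coeff-pmul : ∀ f g → coeff (pmul f g) ≈ coeff f ⊙ coeff g
coeff-pmul []      g = ≈-sym (⊙-zeroˡ (coeff g))
coeff-pmul (x ∷ f) g = pointwise λ where
  zero    → trans (coeff-padd (map (x ℤ.*_) g) _ 0)
              (trans (ℤₚ.+-identityʳ _) (coeff-map (x ℤ.*_) (ℤₚ.*-zeroʳ x) g 0))
  (suc k) → trans (coeff-padd (map (x ℤ.*_) g) _ (suc k))
              (cong₂ ℤ._+_ (coeff-map (x ℤ.*_) (ℤₚ.*-zeroʳ x) g (suc k)) (at (coeff-pmul f g) k))

coeff-vanishes : ∀ f → VanishesFrom (length f) (coeff f)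
coeff-vanishes []      k       l       = refl
coeff-vanishes (x ∷ f) (suc k) (s≤s l) = coeff-vanishes f k l

coeff-singleton : ∀ x → coeff [ x ] ≈ const x
coeff-singleton x = pointwise λ { zero → refl ; (suc k) → refl }

coeff-ext : ∀ f g → length f ≡ length g → (∀ k → k < length f → coeff f k ≡ coeff g k) → f ≡ g
coeff-ext []      []      _ _ = refl
coeff-ext (x ∷ f) (y ∷ g) l e = cong₂ _∷_ (e 0 (s≤s z≤n))
  (coeff-ext f g (ℕₚ.suc-injective l) (λ k k< → e (suc k) (s≤s k<)))

coeff-applyUpTo : ∀ (E : Series) n k → k < n → coeff (applyUpTo E n) k ≡ E k
coeff-applyUpTo E (suc n) zero    _       = refl
coeff-applyUpTo E (suc n) (suc k) (s≤s l) = coeff-applyUpTo (tail E) n k l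

length-padd : ∀ f g → length (padd f g) ≡ length f ⊔ length g
length-padd []      g       = refl
length-padd (x ∷ f) []      = refl
length-padd (x ∷ f) (y ∷ g) = cong suc (length-padd f g)

padd-identityʳ : ∀ f → padd f [] ≡ f
padd-identityʳ []      = refl
padd-identityʳ (x ∷ f) = refl

pmul-singleton : ∀ x y g → pmul [ x ] (y ∷ g) ≡ map (x ℤ.*_) (y ∷ g)
pmul-singleton x y g = cong₂ _∷_ (ℤₚ.+-identityʳ _) (padd-identityʳ _)

length-pmul : ∀ f g {d e} → length f ≡ suc d → length g ≡ suc e → length (pmul f g) ≡ suc (d + e)
length-pmul (x ∷ []) (y ∷ g) refl refl =
  trans (cong length (pmul-singleton x y g)) (Listₚ.length-map (x ℤ.*_) (y ∷ g))
length-pmul (x ∷ f@(_ ∷ _)) g {e = e} refl lg = begin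
  length (padd (map (x ℤ.*_) g) (+ 0 ∷ pmul f g))  ≡⟨ length-padd (map (x ℤ.*_) g) _ ⟩
  length (map (x ℤ.*_) g) ⊔ suc (length (pmul f g)) ≡⟨ cong₂ (λ m n → m ⊔ suc n)
                                                        (trans (Listₚ.length-map (x ℤ.*_) g) lg) (length-pmul f g refl lg) ⟩
  suc e ⊔ suc (length f + e)                       ≡⟨ ℕₚ.m≤n⇒m⊔n≡n (s≤s (ℕₚ.m≤n+m e (length f))) ⟩
  suc (length f + e)                               ∎
  where open ≡-Reasoning

coeff-++ : ∀ f g → coeff (f ++ g) ≈ coeff f ⊕ X^ (length f) ⊙ coeff g
coeff-++ f g = pointwise (go f)
  where
  go : ∀ f k → coeff (f ++ g) k ≡ (coeff f ⊕ X^ (length f) ⊙ coeff g) k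
  go []      k       = sym (trans (ℤₚ.+-identityˡ _) (at (⊙-identityˡ (coeff g)) k))
  go (x ∷ f) zero    = sym (trans (cong (ℤ._+_ x) (ℤₚ.*-zeroˡ (coeff g 0))) (ℤₚ.+-identityʳ x))
  go (x ∷ f) (suc k) = trans (go f k) (cong (ℤ._+_ (coeff f k))
    (sym (trans (cong (ℤ._+ (X^ (length f) ⊙ coeff g) k) (ℤₚ.*-zeroˡ (coeff g (suc k)))) (ℤₚ.+-identityˡ _))))

coeff-reverse-∷ : ∀ x f → coeff (reverse (x ∷ f)) ≈ coeff (reverse f) ⊕ X^ (length f) ⊙ const x
coeff-reverse-∷ x f = begin
  coeff (reverse (x ∷ f))                                        ≡⟨ cong coeff (Listₚ.unfold-reverse x f) ⟩
  coeff (reverse f ++ [ x ])                                     ≈⟨ coeff-++ (reverse f) [ x ] ⟩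
  coeff (reverse f) ⊕ X^ (length (reverse f)) ⊙ coeff [ x ]      ≡⟨ cong (λ n → coeff (reverse f) ⊕ X^ n ⊙ coeff [ x ]) (Listₚ.length-reverse f) ⟩
  coeff (reverse f) ⊕ X^ (length f) ⊙ coeff [ x ]                ≈⟨ ⊕-cong (≈-refl {coeff (reverse f)}) (⊙-cong ≈-refl (coeff-singleton x)) ⟩
  coeff (reverse f) ⊕ X^ (length f) ⊙ const x                    ∎
  where open ≈-Reasoning

coeff-reverse-0 : ∀ f {d} → length f ≡ suc d → coeff (reverse f) 0 ≡ coeff f d
coeff-reverse-0 (x ∷ [])        refl = refl
coeff-reverse-0 (x ∷ f@(_ ∷ _)) refl = begin
  coeff (reverse (x ∷ f)) 0                                    ≡⟨ at (coeff-reverse-∷ x f) 0 ⟩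
  coeff (reverse f) 0 ℤ.+ (X^ (length f) ⊙ const x) 0          ≡⟨ cong₂ ℤ._+_ (coeff-reverse-0 f refl) (X^-⊙-< (length f) (const x) 0 (s≤s z≤n)) ⟩
  coeff f (pred (length f)) ℤ.+ 0ℤ                                             ≡⟨ ℤₚ.+-identityʳ (coeff f (pred (length f))) ⟩
  coeff f (pred (length f))                                    ∎
  where open ≡-Reasoning

-- Reversing a list of length n gives x^(n-1)·f(1/x), so the shorter summand is shifted by the
-- difference e of the lengths.
reverse-padd : ∀ e f g → length g ≡ e + length f →
               coeff (reverse (padd f g)) ≈ coeff (reverse g) ⊕ X^ e ⊙ coeff (reverse f)
reverse-padd e [] g _ = begin
  coeff (reverse g)                     ≈⟨ pointwise (λ k → sym (ℤₚ.+-identityʳ _)) ⟩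
  coeff (reverse g) ⊕ 𝟘                 ≈⟨ ⊕-cong (≈-refl {coeff (reverse g)}) (⊙-zeroˡ (X^ e)) ⟨
  coeff (reverse g) ⊕ 𝟘 ⊙ X^ e          ≈⟨ ⊕-cong (≈-refl {coeff (reverse g)}) (⊙-comm 𝟘 (X^ e)) ⟩
  coeff (reverse g) ⊕ X^ e ⊙ coeff []   ∎
  where open ≈-Reasoning
reverse-padd e (x ∷ f) [] l = ⊥-elim (ℕₚ.0≢1+n (trans l (ℕₚ.+-suc e (length f))))
reverse-padd e (x ∷ f) (y ∷ g) l = begin
  coeff (reverse ((x ℤ.+ y) ∷ padd f g))
    ≈⟨ coeff-reverse-∷ (x ℤ.+ y) (padd f g) ⟩
  coeff (reverse (padd f g)) ⊕ X^ (length (padd f g)) ⊙ const (x ℤ.+ y)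
    ≈⟨ ⊕-cong (reverse-padd e f g lg) (⊙-cong ≈-refl (const-+ x y)) ⟩
  (G ⊕ X^ e ⊙ F) ⊕ X^ (length (padd f g)) ⊙ (const x ⊕ const y)
    ≡⟨ cong (λ n → (G ⊕ X^ e ⊙ F) ⊕ X^ n ⊙ (const x ⊕ const y)) lp ⟩
  (G ⊕ X^ e ⊙ F) ⊕ X^ (length g) ⊙ (const x ⊕ const y)
    ≈⟨ solve 6 (λ G E F L u v → (G :+ E :* F) :+ L :* (u :+ v) := (G :+ L :* v) :+ (E :* F :+ L :* u)) ≈-refl
         G (X^ e) F (X^ (length g)) (const x) (const y) ⟩
  (G ⊕ X^ (length g) ⊙ const y) ⊕ (X^ e ⊙ F ⊕ X^ (length g) ⊙ const x)
    ≈⟨ ⊕-cong (≈-refl {G ⊕ X^ (length g) ⊙ const y}) (⊕-cong (≈-refl {X^ e ⊙ F}) (⊙-cong (≈-trans (X^-+ e (length f)) (≈-reflexive (cong X^ (sym lg)))) ≈-refl)) ⟨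
  (G ⊕ X^ (length g) ⊙ const y) ⊕ (X^ e ⊙ F ⊕ (X^ e ⊙ X^ (length f)) ⊙ const x)
    ≈⟨ ⊕-cong (≈-sym (coeff-reverse-∷ y g))
         (≈-trans (solve 4 (λ E F L u → E :* F :+ (E :* L) :* u := E :* (F :+ L :* u)) ≈-refl (X^ e) F (X^ (length f)) (const x))
                  (⊙-cong ≈-refl (≈-sym (coeff-reverse-∷ x f)))) ⟩
  coeff (reverse (y ∷ g)) ⊕ X^ e ⊙ coeff (reverse (x ∷ f)) ∎
  where
  open ≈-Reasoning
  F = coeff (reverse f)
  G = coeff (reverse g)
  lg : length g ≡ e + length f
  lg = ℕₚ.suc-injective (trans l (ℕₚ.+-suc e (length f)))
  lp : length (padd f g) ≡ length g
  lp = trans (length-padd f g) (ℕₚ.m≤n⇒m⊔n≡n (ℕₚ.≤-trans (ℕₚ.m≤n+m (length f) e) (ℕₚ.≤-reflexive (sym lg))))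

reverse-map : ∀ x f → coeff (reverse (map (x ℤ.*_) f)) ≈ const x ⊙ coeff (reverse f)
reverse-map x f = pointwise λ k → begin
  coeff (reverse (map (x ℤ.*_) f)) k  ≡⟨ cong (λ l → coeff l k) (Listₚ.reverse-map (x ℤ.*_) f) ⟨
  coeff (map (x ℤ.*_) (reverse f)) k  ≡⟨ coeff-map (x ℤ.*_) (ℤₚ.*-zeroʳ x) (reverse f) k ⟩
  x ℤ.* coeff (reverse f) k           ≡⟨ at (const-⊙ x (coeff (reverse f))) k ⟨
  (const x ⊙ coeff (reverse f)) k     ∎
  where open ≡-Reasoning

-- With degrees d and e, x^(d+e)·(fg)(1/x) = x^d·f(1/x) · x^e·g(1/x). This turns division from the
-- highest degree downwards into division of power series.
reverse-pmul : ∀ f g {d e} → length f ≡ suc d → length g ≡ suc e →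
               coeff (reverse (pmul f g)) ≈ coeff (reverse f) ⊙ coeff (reverse g)
reverse-pmul (x ∷ []) g@(y ∷ g′) refl _ = begin
  coeff (reverse (pmul [ x ] g))         ≡⟨ cong (λ l → coeff (reverse l)) (pmul-singleton x y g′) ⟩
  coeff (reverse (map (x ℤ.*_) g))       ≈⟨ reverse-map x g ⟩
  const x ⊙ coeff (reverse g)            ≈⟨ ⊙-cong (coeff-singleton x) ≈-refl ⟨
  coeff [ x ] ⊙ coeff (reverse g)        ∎
  where open ≈-Reasoning
reverse-pmul (x ∷ f@(_ ∷ f′)) g {e = e} refl lg = begin
  coeff (reverse (padd (map (x ℤ.*_) g) (0ℤ ∷ pmul f g)))
    ≈⟨ reverse-padd (length f) (map (x ℤ.*_) g) (0ℤ ∷ pmul f g) lengths ⟩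
  coeff (reverse (0ℤ ∷ pmul f g)) ⊕ X^ (length f) ⊙ coeff (reverse (map (x ℤ.*_) g))
    ≈⟨ ⊕-cong (coeff-reverse-∷ 0ℤ (pmul f g)) (⊙-cong ≈-refl (reverse-map x g)) ⟩
  (coeff (reverse (pmul f g)) ⊕ X^ (length (pmul f g)) ⊙ const 0ℤ) ⊕ X^ (length f) ⊙ (const x ⊙ G)
    ≈⟨ ⊕-cong (⊕-cong (reverse-pmul f g refl lg) ≈-refl) ≈-refl ⟩
  (F ⊙ G ⊕ X^ (length (pmul f g)) ⊙ const 0ℤ) ⊕ X^ (length f) ⊙ (const x ⊙ G)
    ≈⟨ solve 5 (λ F G L M u → (F :* G :+ M :* con 0ℤ) :+ L :* (u :* G) := (F :+ L :* u) :* G) ≈-refl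
         F G (X^ (length f)) (X^ (length (pmul f g))) (const x) ⟩
  (F ⊕ X^ (length f) ⊙ const x) ⊙ G
    ≈⟨ ⊙-cong (coeff-reverse-∷ x f) ≈-refl ⟨
  coeff (reverse (x ∷ f)) ⊙ G ∎
  where
  open ≈-Reasoning
  F = coeff (reverse f)
  G = coeff (reverse g)
  lengths : suc (length (pmul f g)) ≡ length f + length (map (x ℤ.*_) g)
  lengths = trans (cong suc (length-pmul f g refl lg))
    (trans (cong suc (sym (ℕₚ.+-suc (length f′) e)))
           (cong (_+_ (length f)) (sym (trans (Listₚ.length-map (x ℤ.*_) g) lg))))

-- Exact long division

quot-cong : ∀ h {f g} → f ≈ g → quot h f ≈ quot h g
quot-cong h e = pointwise (go e)
  where
  go : ∀ {f g} → f ≈ g → ∀ k → quot h f k ≡ quot h g k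
  go e zero    = cong (h 0 ℤ.*_) (at e 0)
  go e (suc k) = go (pointwise λ j → cong₂ ℤ._+_ (at e (suc j))
    (cong (λ z → ℤ.- (h 0 ℤ.* z ℤ.* h (suc j))) (at e 0))) k

quot-𝟘 : ∀ h k → quot h 𝟘 k ≡ 0ℤ
quot-𝟘 h zero    = ℤₚ.*-zeroʳ (h 0)
quot-𝟘 h (suc k) = trans (at (quot-cong h (pointwise λ j → vanish (h 0) (h (suc j)))) k) (quot-𝟘 h k)
  where
  vanish : ∀ x y → 0ℤ ℤ.+ ℤ.- (x ℤ.* 0ℤ ℤ.* y) ≡ 0ℤ
  vanish = solve-∀

-- On highest-degree-first lists, long division is division of power series.
coeff-divHF : ∀ q g f k → k < q → coeff (divHF q g f) k ≡ quot (coeff (1ℤ ∷ g)) (coeff f) k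
coeff-divHF (suc q) g []      k       _       = sym (quot-𝟘 (coeff (1ℤ ∷ g)) k)
coeff-divHF (suc q) g (x ∷ f) zero    _       = sym (ℤₚ.*-identityˡ x)
coeff-divHF (suc q) g (x ∷ f) (suc k) (s≤s l) = trans
  (coeff-divHF q g (padd f (map (λ y → ℤ.- (x ℤ.* y)) g)) k l)
  (at (quot-cong (coeff (1ℤ ∷ g)) (pointwise λ j → trans (coeff-padd f _ j)
    (cong (ℤ._+_ (coeff f j)) (trans (coeff-map (λ y → ℤ.- (x ℤ.* y)) (cong ℤ.-_ (ℤₚ.*-zeroʳ x)) g j)
      (cong (λ z → ℤ.- (z ℤ.* coeff g j)) (sym (ℤₚ.*-identityˡ x))))))) k)

length-divHF : ∀ q g f → q ≤ length f → length (divHF q g f) ≡ q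
length-divHF zero    g f       _       = refl
length-divHF (suc q) g (x ∷ f) (s≤s l) = cong suc (length-divHF q g _
  (ℕₚ.≤-trans l (ℕₚ.≤-trans (ℕₚ.m≤m⊔n (length f) _) (ℕₚ.≤-reflexive (sym (length-padd f _))))))

record Monic (f : Poly) (d : ℕ) : Set where
  constructor monic
  field
    length≡ : length f ≡ suc d
    leading : coeff f d ≡ 1ℤ

monic-pmul : ∀ {f g d e} → Monic f d → Monic g e → Monic (pmul f g) (d + e)
monic-pmul {f} {g} {d} {e} (monic lf cf) (monic lg cg) = monic (length-pmul f g lf lg)
  (trans (at (coeff-pmul f g) (d + e)) (trans (⊙-top d e
    (λ k l → coeff-vanishes f k (ℕₚ.≤-trans (ℕₚ.≤-reflexive lf) l))
    (λ k l → coeff-vanishes g k (ℕₚ.≤-trans (ℕₚ.≤-reflexive lg) l))) (cong₂ ℤ._*_ cf cg)))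

-- Reversed, the monic g has constant term 1 and can be cancelled in ℤ[[x]], which identifies the
-- quotient as a series. Its length q = d + 1 upgrades this to equality of lists.
pdivMonic-pmul : ∀ g h {e d} → Monic g e → length h ≡ suc d → pdivMonic (pmul g h) g ≡ h
pdivMonic-pmul g h {e} {d} (monic lg cg) lh with reverse g in eq
... | [] = ⊥-elim (ℕₚ.0≢1+n (trans (cong length (sym eq)) (trans (Listₚ.length-reverse g) lg)))
... | y ∷ gt = trans (cong reverse quotient≡) (Listₚ.reverse-involutive h)
  where
  f = pmul g h
  q = length f ∸ length g + 1
  G = coeff (1ℤ ∷ gt)
  open ≡-Reasoning
  y≡1 : y ≡ 1ℤ
  y≡1 = trans (cong (λ l → coeff l 0) (sym eq)) (trans (coeff-reverse-0 g lg) cg)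
  q≡ : q ≡ suc d
  q≡ = begin
    length f ∸ length g + 1       ≡⟨ cong₂ (λ m n → m ∸ n + 1) (length-pmul g h lg lh) lg ⟩
    suc (e + d) ∸ suc e + 1       ≡⟨ cong (_+ 1) (ℕₚ.m+n∸m≡n e d) ⟩
    d + 1                         ≡⟨ ℕₚ.+-comm d 1 ⟩
    suc d                         ∎
  q≤ : q ≤ length (reverse f)
  q≤ = ℕₚ.≤-trans (ℕₚ.≤-reflexive q≡) (ℕₚ.≤-trans (s≤s (ℕₚ.m≤n+m d e))
         (ℕₚ.≤-reflexive (sym (trans (Listₚ.length-reverse f) (length-pmul g h lg lh)))))
  series : quot G (coeff (reverse f)) ≈ coeff (reverse h)
  series = ⊙-cancelʳ G refl (≈-trans (quot-⊙ G (coeff (reverse f)) refl)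
    (≈-trans (reverse-pmul g h lg lh) (≈-trans (⊙-comm (coeff (reverse g)) (coeff (reverse h)))
      (⊙-cong ≈-refl (pointwise λ k → cong (λ l → coeff l k) (trans eq (cong (_∷ gt) y≡1)))))))
  length≡q : length (divHF q gt (reverse f)) ≡ q
  length≡q = length-divHF q gt (reverse f) q≤
  quotient≡ : divHF q gt (reverse f) ≡ reverse h
  quotient≡ = coeff-ext _ _
    (trans length≡q (trans q≡ (sym (trans (Listₚ.length-reverse h) lh))))
    (λ k l → trans (coeff-divHF q gt (reverse f) k (subst (k <_) length≡q l)) (at series k))

coeff-replicate : ∀ n k → coeff (replicate n 0ℤ) k ≡ 0ℤ
coeff-replicate zero    k       = refl
coeff-replicate (suc n) zero    = refl
coeff-replicate (suc n) (suc k) = coeff-replicate n k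

coeff-xn-1 : ∀ n → 1 ≤ n → coeff (xn-1 n) ≈ X^-1 n
coeff-xn-1 (suc n) _ = pointwise λ { zero → refl ; (suc k) → go k }
  where
  open ≡-Reasoning
  go : ∀ k → coeff (replicate n 0ℤ ++ [ 1ℤ ]) k ≡ X^ n k ℤ.+ 0ℤ
  go k = begin
    coeff (replicate n 0ℤ ++ [ 1ℤ ]) k
      ≡⟨ at (coeff-++ (replicate n 0ℤ) [ 1ℤ ]) k ⟩
    coeff (replicate n 0ℤ) k ℤ.+ (X^ (length (replicate n 0ℤ)) ⊙ coeff [ 1ℤ ]) k
      ≡⟨ cong₂ ℤ._+_ (coeff-replicate n k) (cong (λ m → (X^ m ⊙ coeff [ 1ℤ ]) k) (Listₚ.length-replicate n)) ⟩
    0ℤ ℤ.+ (X^ n ⊙ coeff [ 1ℤ ]) k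
      ≡⟨ ℤₚ.+-identityˡ _ ⟩
    (X^ n ⊙ coeff [ 1ℤ ]) k
      ≡⟨ at (≈-trans (⊙-cong ≈-refl (coeff-singleton 1ℤ)) (≈-trans (⊙-comm (X^ n) 𝟙) (⊙-identityˡ (X^ n)))) k ⟩
    X^ n k
      ≡⟨ ℤₚ.+-identityʳ _ ⟨
    X^ n k ℤ.+ 0ℤ ∎

length-xn-1 : ∀ n → 1 ≤ n → length (xn-1 n) ≡ suc n
length-xn-1 (suc n) _ = cong suc (trans (Listₚ.length-++ (replicate n 0ℤ))
  (trans (cong (_+ 1) (Listₚ.length-replicate n)) (ℕₚ.+-comm n 1)))

series-degree : ∀ K (E : Series) → VanishesFrom K E → E ≈ 𝟘 ⊎ ∃ λ d → E d ≢ 0ℤ × VanishesFrom (suc d) E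
series-degree zero    E v = inj₁ (pointwise λ k → v k z≤n)
series-degree (suc K) E v with E K ℤ.≟ 0ℤ
... | no ≢0   = inj₂ (K , ≢0 , v)
... | yes ≡0 = series-degree K E λ k l → below k (ℕₚ.m≤n⇒m<n∨m≡n l)
  where
  below : ∀ k → K < k ⊎ K ≡ k → E k ≡ 0ℤ
  below k (inj₁ l)    = v k l
  below k (inj₂ refl) = ≡0

1≢0 : 1ℤ ≢ 0ℤ
1≢0 ()

-- If d is the degree of E, the coefficient of E·g at d + e is E(d) ≠ 0. Hence d + e is the degree n
-- of x^n - 1, and E(d) = 1. The first d + 1 coefficients of E form a monic list h whose product
-- with g is `xn-1 n`, so the division returns h.
pdivMonic-exact : ∀ n g {e} E → 1 ≤ n → Monic g e → Finite E → E ⊙ coeff g ≈ X^-1 n →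
  coeff (pdivMonic (xn-1 n) g) ≈ E × ∃ λ d → Monic (pdivMonic (xn-1 n) g) d
pdivMonic-exact n g {e} E 1≤n mg@(monic lg cg) (K , vanish) eq with series-degree K E vanish
... | inj₁ E≈0 = ⊥-elim (1≢0 (trans (sym (X^-1-top n 1≤n)) (trans (sym (at eq n))
        (trans (at (⊙-cong E≈0 (≈-refl {coeff g})) n) (at (⊙-zeroˡ (coeff g)) n)))))
... | inj₂ (d , Ed≢0 , vd) = subst (λ p → coeff p ≈ E × ∃ (Monic p)) (sym h≡)
        (h≈E , d , monic lh (trans (coeff-applyUpTo E (suc d) d ℕₚ.≤-refl) Ed≡1))
  where
  h = applyUpTo E (suc d)
  lh : length h ≡ suc d
  lh = Listₚ.length-applyUpTo E (suc d)
  h≈E : coeff h ≈ E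
  h≈E = pointwise λ k → case k (ℕₚ.<-≤-connex k (suc d))
    where
    case : ∀ k → k < suc d ⊎ suc d ≤ k → coeff h k ≡ E k
    case k (inj₁ l) = coeff-applyUpTo E (suc d) k l
    case k (inj₂ l) = trans (coeff-vanishes h k (ℕₚ.≤-trans (ℕₚ.≤-reflexive lh) l)) (sym (vd k l))
  vg : VanishesFrom (suc e) (coeff g)
  vg k l = coeff-vanishes g k (ℕₚ.≤-trans (ℕₚ.≤-reflexive lg) l)
  Ed : X^-1 n (d + e) ≡ E d
  Ed = trans (sym (at eq (d + e))) (trans (⊙-top d e vd vg) (trans (cong (E d ℤ.*_) cg) (ℤₚ.*-identityʳ (E d))))
  n≢0 : n ≢ 0
  n≢0 refl = ℕₚ.1+n≰n 1≤n
  -- Needed to exclude d + e = 0, the other place where x^n - 1 has a nonzero coefficient.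
  n≤d+e : n ≤ d + e
  n≤d+e with ℕₚ.<-≤-connex (d + e) n
  ... | inj₂ l = l
  ... | inj₁ l = ⊥-elim (1≢0 (trans (sym (X^-1-top n 1≤n)) (trans (sym (at eq n))
          (⊙-vanishes (suc d) (suc e) vd vg n (s≤s (ℕₚ.≤-trans (ℕₚ.≤-reflexive (ℕₚ.+-suc d e)) l))))))
  d+e≡n : d + e ≡ n
  d+e≡n with d + e ℕₚ.≟ n
  ... | yes p = p
  ... | no ne = ⊥-elim (Ed≢0 (trans (sym Ed) (cong₂ (λ x y → x ℤ.+ ℤ.- y) (X^-≢ n (d + e) ne)
                  (X^-≢ 0 (d + e) (λ z → n≢0 (ℕₚ.n≤0⇒n≡0 (ℕₚ.≤-trans n≤d+e (ℕₚ.≤-reflexive z))))))))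
  Ed≡1 : E d ≡ 1ℤ
  Ed≡1 = trans (sym Ed) (trans (cong (X^-1 n) d+e≡n) (X^-1-top n 1≤n))
  f≡ : xn-1 n ≡ pmul g h
  f≡ = coeff-ext _ _
    (trans (length-xn-1 n 1≤n) (sym (trans (length-pmul g h lg lh) (cong suc (trans (ℕₚ.+-comm e d) d+e≡n)))))
    (λ k _ → at (≈-trans (coeff-xn-1 n 1≤n) (≈-trans (≈-sym eq) (≈-trans (⊙-comm E (coeff g))
      (≈-trans (⊙-cong ≈-refl (≈-sym h≈E)) (≈-sym (coeff-pmul g h)))))) k)
  h≡ : pdivMonic (xn-1 n) g ≡ h
  h≡ = trans (cong (λ f → pdivMonic f g) f≡) (pdivMonic-pmul g h mg lh)

-- Products over divisors

Π : ℕ → (ℕ → Series) → Series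
Π zero    F = 𝟙
Π (suc n) F = F (suc n) ⊙ Π n F

select : {P : Set} → Dec P → Series → Series
select (yes _) f = f
select (no _)  f = 𝟙

-- The product over the d ≤ j that divide N. The bound j is separate from N because `table` grows
-- entry by entry; j = N - 1 gives the divisor in the definition of Φ_N.
divisorProduct : ℕ → ℕ → (ℕ → Series) → Series
divisorProduct N j F = Π j λ d → select (d ∣? N) (F d)

select-yes : ∀ {P} (P? : Dec P) f → P → select P? f ≡ f
select-yes (yes _) f p = refl
select-yes (no ¬p) f p = ⊥-elim (¬p p)

select-no : ∀ {P} (P? : Dec P) f → ¬ P → select P? f ≡ 𝟙
select-no (yes p) f ¬p = ⊥-elim (¬p p)
select-no (no _)  f ¬p = refl

divisorProduct-self : ∀ n F → divisorProduct (suc n) (suc n) F ≈ F (suc n) ⊙ divisorProduct (suc n) n F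
divisorProduct-self n F = ⊙-cong (≈-reflexive (select-yes (suc n ∣? suc n) (F (suc n)) ∣-refl)) ≈-refl

divisorProduct-stable : ∀ n j F → 1 ≤ n → n ≤ j → divisorProduct n j F ≈ divisorProduct n n F
divisorProduct-stable n zero    F 1≤n n≤j = ⊥-elim (ℕₚ.1+n≰n (ℕₚ.≤-trans 1≤n n≤j))
divisorProduct-stable n@(suc _) (suc j) F 1≤n n≤j with ℕₚ.m≤n⇒m<n∨m≡n n≤j
... | inj₂ refl      = ≈-refl
... | inj₁ (s≤s n≤j′) = ≈-trans
  (⊙-cong (≈-reflexive (select-no (suc j ∣? n) (F (suc j)) (λ j∣n → ℕₚ.1+n≰n (ℕₚ.≤-trans (∣⇒≤ j∣n) n≤j′)))) ≈-refl)
  (≈-trans (⊙-identityˡ _) (divisorProduct-stable n j F 1≤n n≤j′))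

-- The table of cyclotomic polynomials is correct

φ : ℕ → Series
φ n = coeff (Φ n)

lastPoly-++ : ∀ t d p → lastPoly (t ++ [ (d , p) ]) ≡ p
lastPoly-++ []          d p = refl
lastPoly-++ (_ ∷ [])    d p = refl
lastPoly-++ (_ ∷ y ∷ t) d p = lastPoly-++ (y ∷ t) d p

Φ-suc : ∀ n → Φ (suc n) ≡ pdivMonic (xn-1 (suc n)) (prodDiv (suc n) (table n))
Φ-suc n = lastPoly-++ (table n) (suc n) _

table-suc : ∀ n → table (suc n) ≡ table n ++ [ (suc n , Φ (suc n)) ]
table-suc n = cong (λ p → table n ++ [ (suc n , p) ]) (sym (Φ-suc n))

prodDiv-++ : ∀ N t d p → coeff (prodDiv N (t ++ [ (d , p) ])) ≈ select (d ∣? N) (coeff p) ⊙ coeff (prodDiv N t)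
prodDiv-++ N [] d p with d ∣? N
... | yes _ = coeff-pmul p [ 1ℤ ]
... | no _  = ≈-sym (⊙-identityˡ (coeff [ 1ℤ ]))
prodDiv-++ N ((e , q) ∷ t) d p with e ∣? N
... | no _  = prodDiv-++ N t d p
... | yes _ = begin
  coeff (pmul q (prodDiv N (t ++ [ (d , p) ])))    ≈⟨ coeff-pmul q _ ⟩
  coeff q ⊙ coeff (prodDiv N (t ++ [ (d , p) ]))   ≈⟨ ⊙-cong ≈-refl (prodDiv-++ N t d p) ⟩
  coeff q ⊙ (s ⊙ coeff (prodDiv N t))              ≈⟨ solve 3 (λ q s r → q :* (s :* r) := s :* (q :* r)) ≈-refl (coeff q) s (coeff (prodDiv N t)) ⟩
  s ⊙ (coeff q ⊙ coeff (prodDiv N t))              ≈⟨ ⊙-cong ≈-refl (coeff-pmul q (prodDiv N t)) ⟨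
  s ⊙ coeff (pmul q (prodDiv N t))                 ∎
  where
  open ≈-Reasoning
  s = select (d ∣? N) (coeff p)

prodDiv-table : ∀ N j → coeff (prodDiv N (table j)) ≈ divisorProduct N j φ
prodDiv-table N zero    = coeff-singleton 1ℤ
prodDiv-table N (suc j) = ≈-trans (≈-reflexive (cong (coeff ∘ prodDiv N) (table-suc j)))
  (≈-trans (prodDiv-++ N (table j) (suc j) (Φ (suc j))) (⊙-cong ≈-refl (prodDiv-table N j)))

IsMonic : Poly → Set
IsMonic p = ∃ λ d → Monic p d

prodDiv-monic : ∀ N t → All (IsMonic ∘ proj₂) t → IsMonic (prodDiv N t)
prodDiv-monic N []            []              = 0 , monic refl refl
prodDiv-monic N ((d , p) ∷ t) ((e , m) ∷ ms) with d ∣? N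
... | no _  = prodDiv-monic N t ms
... | yes _ = _ , monic-pmul m (proj₂ (prodDiv-monic N t ms))

table-monic : ∀ j → (∀ d → 1 ≤ d → d ≤ j → IsMonic (Φ d)) → All (IsMonic ∘ proj₂) (table j)
table-monic zero    h = []
table-monic (suc j) h = subst (All (IsMonic ∘ proj₂)) (sym (table-suc j))
  (Allₚ.++⁺ (table-monic j (λ d l l′ → h d l (ℕₚ.m≤n⇒m≤1+n l′))) (h (suc j) (s≤s z≤n) ℕₚ.≤-refl ∷ []))

-- Comaximality and exactness of the defining divisions

Divides : Series → Series → Set
Divides A C = ∃ λ E → Finite E × E ⊙ A ≈ C

-- For polynomials this is comaximality in ℚ[x].
Comaximal : Series → Series → Set
Comaximal A B = ∃₂ λ u v → ∃ λ D → Finite u × Finite v × D ≢ 0ℤ × u ⊙ A ⊕ v ⊙ B ≈ const D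

comaximal-𝟙 : ∀ A → Comaximal A 𝟙
comaximal-𝟙 A = const 0ℤ , 𝟙 , 1ℤ , finite-const 0ℤ , finite-const 1ℤ , (λ ()) ,
  solve 1 (λ A → con 0ℤ :* A :+ con 1ℤ :* con 1ℤ := con 1ℤ) ≈-refl A

-- Multiply the two relations and collect the terms that contain A.
comaximal-⊙ : ∀ {A B C} → Finite A → Finite B → Finite C → Comaximal A B → Comaximal A C → Comaximal A (B ⊙ C)
comaximal-⊙ {A} {B} {C} fA fB fC (u , v , D , fu , fv , D≢0 , e) (u′ , v′ , D′ , fu′ , fv′ , D′≢0 , e′) =
  u ⊙ (u′ ⊙ A ⊕ v′ ⊙ C) ⊕ (v ⊙ B) ⊙ u′ , v ⊙ v′ , D ℤ.* D′ ,
  finite-⊕ (finite-⊙ fu (finite-⊕ (finite-⊙ fu′ fA) (finite-⊙ fv′ fC))) (finite-⊙ (finite-⊙ fv fB) fu′) ,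
  finite-⊙ fv fv′ ,
  nonzero ,
  (begin
    (u ⊙ (u′ ⊙ A ⊕ v′ ⊙ C) ⊕ (v ⊙ B) ⊙ u′) ⊙ A ⊕ (v ⊙ v′) ⊙ (B ⊙ C)
      ≈⟨ solve 7 (λ A B C u v u′ v′ →
           (u :* (u′ :* A :+ v′ :* C) :+ (v :* B) :* u′) :* A :+ (v :* v′) :* (B :* C)
             := (u :* A :+ v :* B) :* (u′ :* A :+ v′ :* C)) ≈-refl A B C u v u′ v′ ⟩
    (u ⊙ A ⊕ v ⊙ B) ⊙ (u′ ⊙ A ⊕ v′ ⊙ C)  ≈⟨ ⊙-cong e e′ ⟩
    const D ⊙ const D′                    ≈⟨ const-* D D′ ⟨
    const (D ℤ.* D′)                      ∎)
  where
  open ≈-Reasoning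
  nonzero : D ℤ.* D′ ≢ 0ℤ
  nonzero z with ℤₚ.i*j≡0⇒i≡0∨j≡0 D z
  ... | inj₁ p = D≢0 p
  ... | inj₂ p = D′≢0 p

-- E = C/(AB) exists as a power series, and uA + vB = D gives D·E = u·(C/B) + v·(C/A). The right
-- side is finite, so E is finite, ℤ having no zero divisors.
divides-⊙ : ∀ {A B C} → IsUnit A → IsUnit B → Comaximal A B → Divides A C → Divides B C → Divides (A ⊙ B) C
divides-⊙ {A} {B} {C} uA uB (u , v , D , fu , fv , D≢0 , e) (E₁ , f₁ , e₁) (E₂ , f₂ , e₂) =
  E , finite-unscale D≢0 (finite-resp-≈ combination (finite-⊕ (finite-⊙ fu f₂) (finite-⊙ fv f₁))) , E⊙AB
  where
  open ≈-Reasoning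
  E = quot (A ⊙ B) C
  E⊙AB : E ⊙ (A ⊙ B) ≈ C
  E⊙AB = quot-⊙ (A ⊙ B) C (unit-⊙ A B uA uB)
  E₂≈ : E₂ ≈ E ⊙ A
  E₂≈ = ⊙-cancelʳ B uB (≈-trans e₂ (≈-trans (≈-sym E⊙AB) (≈-sym (⊙-assoc E A B))))
  E₁≈ : E₁ ≈ E ⊙ B
  E₁≈ = ⊙-cancelʳ A uA (≈-trans e₁ (≈-trans (≈-sym E⊙AB)
    (solve 3 (λ E A B → E :* (A :* B) := (E :* B) :* A) ≈-refl E A B)))
  combination : u ⊙ E₂ ⊕ v ⊙ E₁ ≈ const D ⊙ E
  combination = begin
    u ⊙ E₂ ⊕ v ⊙ E₁              ≈⟨ ⊕-cong (⊙-cong (≈-refl {u}) E₂≈) (⊙-cong (≈-refl {v}) E₁≈) ⟩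
    u ⊙ (E ⊙ A) ⊕ v ⊙ (E ⊙ B)    ≈⟨ solve 5 (λ u v E A B → u :* (E :* A) :+ v :* (E :* B) := (u :* A :+ v :* B) :* E) ≈-refl u v E A B ⟩
    (u ⊙ A ⊕ v ⊙ B) ⊙ E          ≈⟨ ⊙-cong e ≈-refl ⟩
    const D ⊙ E                  ∎

X^-1-multiple : ∀ {g d} → g ∣ d → Divides (X^-1 g) (X^-1 d)
X^-1-multiple {g} (divides m refl) = geometric g m , finite-geometric g m , geometric-⊙ g m

-- If i·d = g + j·e, then x^g - 1 = (x^(id) - 1) - x^g·(x^(je) - 1), a combination of x^d - 1 and
-- x^e - 1.
X^-1-bezout : ∀ {g d e} → Bézout.Identity.Identity g d e →
  ∃₂ λ u v → Finite u × Finite v × u ⊙ X^-1 d ⊕ v ⊙ X^-1 e ≈ X^-1 g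
X^-1-bezout {g} {d} {e} (Bézout.Identity.+- x y eq) =
  geometric d x , ⊖ (X^ g ⊙ geometric e y) , finite-geometric d x ,
  finite-⊖ (finite-⊙ (finite-X^ g) (finite-geometric e y)) , (begin
    s ⊙ X^-1 d ⊕ ⊖ (X^ g ⊙ t) ⊙ X^-1 e     ≈⟨ solve 4 (λ sd g t e → sd :+ (:- (g :* t)) :* e := sd :- g :* (t :* e)) ≈-refl (s ⊙ X^-1 d) (X^ g) t (X^-1 e) ⟩
    s ⊙ X^-1 d ⊕ ⊖ (X^ g ⊙ (t ⊙ X^-1 e))   ≈⟨ ⊕-cong (≈-trans (geometric-⊙ d x) (≈-trans (≈-reflexive (cong X^-1 (sym eq))) (X^-1-+ g (y * e)))) (⊖-cong (⊙-cong ≈-refl (geometric-⊙ e y))) ⟩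
    (X^ g ⊙ X^-1 (y * e) ⊕ X^-1 g) ⊕ ⊖ (X^ g ⊙ X^-1 (y * e)) ≈⟨ solve 2 (λ p q → (p :+ q) :- p := q) ≈-refl (X^ g ⊙ X^-1 (y * e)) (X^-1 g) ⟩
    X^-1 g ∎)
  where
  open ≈-Reasoning
  s = geometric d x
  t = geometric e y
X^-1-bezout {g} {d} {e} (Bézout.Identity.-+ x y eq)
  with X^-1-bezout {g} {e} {d} (Bézout.Identity.+- y x eq)
... | u , v , fu , fv , e′ = v , u , fv , fu ,
  ≈-trans (solve 2 (λ p q → p :+ q := q :+ p) ≈-refl (v ⊙ X^-1 d) (u ⊙ X^-1 e)) e′

-- Both facts go through one strong induction: `Φ-monic` makes the next divisor monic, and
-- `Φ-product` feeds the comaximality argument that makes the next division exact.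
record Good (n : ℕ) : Set where
  field
    Φ-monic   : IsMonic (Φ n)
    Φ-product : divisorProduct n n φ ≈ X^-1 n
open Good

GoodBelow : ℕ → Set
GoodBelow N = ∀ d → 1 ≤ d → d < N → Good d

φ-finite : ∀ n → Finite (φ n)
φ-finite n = length (Φ n) , coeff-vanishes (Φ n)

divisorProduct-finite : ∀ N j → Finite (divisorProduct N j φ)
divisorProduct-finite N zero    = finite-const 1ℤ
divisorProduct-finite N (suc j) with suc j ∣? N
... | yes _ = finite-⊙ (φ-finite (suc j)) (divisorProduct-finite N j)
... | no _  = finite-⊙ (finite-const 1ℤ) (divisorProduct-finite N j)

φ⊙rest : ∀ n → Good (suc n) → φ (suc n) ⊙ divisorProduct (suc n) n φ ≈ X^-1 (suc n)
φ⊙rest n G = ≈-trans (≈-sym (divisorProduct-self n φ)) (Φ-product G)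

φ-unit : ∀ n → 1 ≤ n → Good n → IsUnit (φ n)
φ-unit (suc n) 1≤n G = unit-factorˡ (φ (suc n)) (divisorProduct (suc n) n φ)
  (unit-resp-≈ (≈-sym (φ⊙rest n G)) (unit-X^-1 (suc n) 1≤n))

divisorProduct-unit : ∀ N j → GoodBelow (suc j) → IsUnit (divisorProduct N j φ)
divisorProduct-unit N zero    h = unit-𝟙
divisorProduct-unit N (suc j) h with suc j ∣? N | divisorProduct-unit N j (λ d l l′ → h d l (ℕₚ.m≤n⇒m≤1+n l′))
... | yes _ | u = unit-⊙ (φ (suc j)) (divisorProduct N j φ) (φ-unit (suc j) (s≤s z≤n) (h (suc j) (s≤s z≤n) ℕₚ.≤-refl)) u
... | no _  | u = unit-⊙ 𝟙 (divisorProduct N j φ) unit-𝟙 u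

φ∣X^-1 : ∀ d {N} → 1 ≤ d → Good d → d ∣ N → Divides (φ d) (X^-1 N)
φ∣X^-1 (suc d) {N} 1≤d G d∣N with X^-1-multiple d∣N
... | E , fE , eE = E ⊙ R , finite-⊙ fE (divisorProduct-finite (suc d) d) , (begin
  (E ⊙ R) ⊙ φ (suc d)    ≈⟨ solve 3 (λ E R f → (E :* R) :* f := E :* (f :* R)) ≈-refl E R (φ (suc d)) ⟩
  E ⊙ (φ (suc d) ⊙ R)    ≈⟨ ⊙-cong ≈-refl (φ⊙rest d G) ⟩
  E ⊙ X^-1 (suc d)       ≈⟨ eE ⟩
  X^-1 N                 ∎)
  where
  open ≈-Reasoning
  R = divisorProduct (suc d) d φ

divisorProduct-∣ : ∀ {g d} j → g ∣ d → Divides (divisorProduct g j φ) (divisorProduct d j φ)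
divisorProduct-∣ zero g∣d = 𝟙 , finite-const 1ℤ , ⊙-identityˡ 𝟙
divisorProduct-∣ {g} {d} (suc j) g∣d with divisorProduct-∣ {g} {d} j g∣d | suc j ∣? g | suc j ∣? d
... | K , fK , eK | yes p | no ¬p = ⊥-elim (¬p (∣-trans p g∣d))
... | K , fK , eK | no _  | no _  = K , fK , ≈-trans (⊙-cong ≈-refl (⊙-identityˡ _)) (≈-trans eK (≈-sym (⊙-identityˡ _)))
... | K , fK , eK | yes _ | yes _ = K , fK ,
  ≈-trans (solve 3 (λ K f r → K :* (f :* r) := f :* (K :* r)) ≈-refl K (φ (suc j)) (divisorProduct g j φ))
          (⊙-cong ≈-refl eK)
... | K , fK , eK | no _  | yes _ = φ (suc j) ⊙ K , finite-⊙ (φ-finite (suc j)) fK ,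
  ≈-trans (solve 3 (λ K f r → (f :* K) :* (con 1ℤ :* r) := f :* (K :* r)) ≈-refl K (φ (suc j)) (divisorProduct g j φ))
          (⊙-cong ≈-refl eK)

-- With g = gcd d e < d, the polynomial φ d divides (x^d - 1)/(x^g - 1), which is congruent to d/g
-- modulo x^g - 1, while x^g - 1 lies in the ideal generated by φ d and φ e.
φ-comaximal : ∀ {d e} → 1 ≤ e → e < d → GoodBelow (suc d) → Comaximal (φ d) (φ e)
φ-comaximal {suc d′} {e@(suc e′)} 1≤e e<d good = combine
  where
  d = suc d′
  g = gcd d e
  g∣d : g ∣ d
  g∣d = gcd[m,n]∣m d e
  g≤e : g ≤ e
  g≤e = ∣⇒≤ (gcd[m,n]∣n d e)
  1≤g : 1 ≤ g
  1≤g = ℕₚ.n≢0⇒n>0 λ g≡0 → 0∤ (subst (_∣ d) g≡0 g∣d)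
    where
    0∤ : ¬ (0 ∣ d)
    0∤ (divides q eq) = ℕₚ.0≢1+n (sym (trans eq (ℕₚ.*-zeroʳ q)))
  Gd : Good d
  Gd = good d (s≤s z≤n) ℕₚ.≤-refl
  Ge : Good e
  Ge = good e 1≤e (ℕₚ.m≤n⇒m≤1+n e<d)
  Gg : Good g
  Gg = good g 1≤g (ℕₚ.m≤n⇒m≤1+n (ℕₚ.≤-<-trans g≤e e<d))
  Rd = divisorProduct d d′ φ
  Re = divisorProduct e e′ φ
  Q = X^-1 g
  combine : Comaximal (φ d) (φ e)
  combine with g∣d | divisorProduct-∣ {g} {d} d′ g∣d | X^-1-bezout (Bézout.identity (gcd-GCD d e))
  ... | divides m d≡mg | K , fK , eK | u , v , fu , fv , bez with geometric-remainder g m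
  -- K stands for the product of the Φ_i over those divisors i < d of d that do not divide g, so
  -- Φ_d·K = (x^d - 1)/(x^g - 1) = m + T·Q. Writing Q through x^d - 1 = Φ_d·Rd and x^e - 1 = Φ_e·Re
  -- and solving for m gives the two multipliers.
  ... | T , fT , rem = K ⊕ ⊖ (T ⊙ (u ⊙ Rd)) , ⊖ (T ⊙ (v ⊙ Re)) , + m ,
    finite-⊕ fK (finite-⊖ (finite-⊙ fT (finite-⊙ fu (divisorProduct-finite d d′)))) ,
    finite-⊖ (finite-⊙ fT (finite-⊙ fv (divisorProduct-finite e e′))) ,
    (λ m≡0 → ℕₚ.0≢1+n (sym (trans d≡mg (cong (_* g) (ℤₚ.+-injective m≡0))))) ,
    (begin
      (K ⊕ ⊖ (T ⊙ (u ⊙ Rd))) ⊙ φ d ⊕ ⊖ (T ⊙ (v ⊙ Re)) ⊙ φ e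
        ≈⟨ solve 8 (λ K T u v Rd Re d e → (K :- T :* (u :* Rd)) :* d :+ (:- (T :* (v :* Re))) :* e
             := d :* K :- T :* (u :* (d :* Rd) :+ v :* (e :* Re))) ≈-refl K T u v Rd Re (φ d) (φ e) ⟩
      φ d ⊙ K ⊕ ⊖ (T ⊙ (u ⊙ (φ d ⊙ Rd) ⊕ v ⊙ (φ e ⊙ Re)))
        ≈⟨ ⊕-cong φK≈ (⊖-cong (⊙-cong (≈-refl {T}) (⊕-cong (⊙-cong (≈-refl {u}) (φ⊙rest d′ Gd)) (⊙-cong (≈-refl {v}) (φ⊙rest e′ Ge))))) ⟩
      (const (+ m) ⊕ T ⊙ Q) ⊕ ⊖ (T ⊙ (u ⊙ X^-1 d ⊕ v ⊙ X^-1 e))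
        ≈⟨ ⊕-cong (≈-refl {const (+ m) ⊕ T ⊙ Q}) (⊖-cong (⊙-cong (≈-refl {T}) bez)) ⟩
      (const (+ m) ⊕ T ⊙ Q) ⊕ ⊖ (T ⊙ Q)
        ≈⟨ solve 2 (λ p q → (p :+ q) :- q := p) ≈-refl (const (+ m)) (T ⊙ Q) ⟩
      const (+ m) ∎)
    where
    open ≈-Reasoning
    Rd≈ : Rd ≈ K ⊙ Q
    Rd≈ = ≈-trans (≈-sym eK) (⊙-cong ≈-refl
      (≈-trans (divisorProduct-stable g d′ φ 1≤g (ℕₚ.≤-trans g≤e (ℕₚ.≤-pred e<d))) (Φ-product Gg)))
    φK≈ : φ d ⊙ K ≈ const (+ m) ⊕ T ⊙ Q
    φK≈ = ≈-trans (⊙-cancelʳ Q (unit-X^-1 g 1≤g) (begin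
      (φ d ⊙ K) ⊙ Q        ≈⟨ ⊙-assoc (φ d) K Q ⟩
      φ d ⊙ (K ⊙ Q)        ≈⟨ ⊙-cong ≈-refl Rd≈ ⟨
      φ d ⊙ Rd             ≈⟨ φ⊙rest d′ Gd ⟩
      X^-1 d               ≈⟨ ≈-reflexive (cong X^-1 d≡mg) ⟩
      X^-1 (m * g)         ≈⟨ geometric-⊙ g m ⟨
      geometric g m ⊙ Q    ∎)) rem

φ-comaximal-product : ∀ N {d} j → j < d → GoodBelow (suc d) → Comaximal (φ d) (divisorProduct N j φ)
φ-comaximal-product N {d} zero    j<d good = comaximal-𝟙 (φ d)
φ-comaximal-product N {d} (suc j) j<d good
  with suc j ∣? N | φ-comaximal-product N {d} j (ℕₚ.<-trans (ℕₚ.n<1+n j) j<d) good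
... | yes _ | r = comaximal-⊙ (φ-finite d) (φ-finite (suc j)) (divisorProduct-finite N j) (φ-comaximal (s≤s z≤n) j<d good) r
... | no _  | r = comaximal-⊙ (φ-finite d) (finite-const 1ℤ) (divisorProduct-finite N j) (comaximal-𝟙 (φ d)) r

product∣X^-1 : ∀ N j → GoodBelow (suc j) → Divides (divisorProduct N j φ) (X^-1 N)
product∣X^-1 N zero    good = X^-1 N , finite-X^-1 N , ≈-trans (⊙-comm (X^-1 N) 𝟙) (⊙-identityˡ (X^-1 N))
product∣X^-1 N (suc j) good
  with suc j ∣? N | product∣X^-1 N j (λ d l l′ → good d l (ℕₚ.m≤n⇒m≤1+n l′))
... | no _  | E , fE , eE = E , fE , ≈-trans (⊙-cong ≈-refl (⊙-identityˡ _)) eE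
... | yes p | r = divides-⊙ (φ-unit (suc j) (s≤s z≤n) Gj) (divisorProduct-unit N j (λ d l l′ → good d l (ℕₚ.m≤n⇒m≤1+n l′)))
                    (φ-comaximal-product N j ℕₚ.≤-refl good) (φ∣X^-1 (suc j) (s≤s z≤n) Gj p) r
  where
  Gj : Good (suc j)
  Gj = good (suc j) (s≤s z≤n) ℕₚ.≤-refl

-- The earlier Φ_d with d ∣ n + 1 have a product that divides x^(n+1) - 1 with a finite quotient E;
-- hence the long division is exact and returns E.
good-step : ∀ n → GoodBelow (suc n) → Good (suc n)
good-step n good with product∣X^-1 (suc n) n good | prodDiv-monic (suc n) (table n) (table-monic n λ d l l′ → Φ-monic (good d l (s≤s l′)))
... | E , fE , eE | e , m with pdivMonic-exact (suc n) (prodDiv (suc n) (table n)) E (s≤s z≤n) m fE (≈-trans (⊙-cong ≈-refl (prodDiv-table (suc n) n)) eE)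
... | q≈E , q-monic = record
  { Φ-monic   = subst IsMonic (sym (Φ-suc n)) q-monic
  ; Φ-product = ≈-trans (divisorProduct-self n φ)
      (≈-trans (⊙-cong (≈-trans (≈-reflexive (cong coeff (Φ-suc n))) q≈E) ≈-refl) eE)
  }

goodBelow : ∀ N → GoodBelow N
goodBelow (suc N) d 1≤d (s≤s d≤N) with ℕₚ.m≤n⇒m<n∨m≡n d≤N
... | inj₁ d<N = goodBelow N d 1≤d d<N
goodBelow (suc (suc N)) (suc .N) 1≤d (s≤s d≤N) | inj₂ refl = good-step N (goodBelow (suc N))

allGood : ∀ n → 1 ≤ n → Good n
allGood n 1≤n = goodBelow (suc n) n 1≤n ℕₚ.≤-refl

-- The substitution x ↦ x^p

-- x^r f(x^(p+1))
spread : ℕ → ℕ → Series → Series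
spread p zero    f zero    = f 0
spread p zero    f (suc k) = spread p p (tail f) k
spread p (suc r) f zero    = 0ℤ
spread p (suc r) f (suc k) = spread p r f k

-- f(x^p); only meaningful for p ≥ 1.
sub : ℕ → Series → Series
sub p = spread (pred p) 0

spread-cong : ∀ p r {f g} → f ≈ g → spread p r f ≈ spread p r g
spread-cong p r e = pointwise (go r e)
  where
  go : ∀ r {f g} → f ≈ g → ∀ k → spread p r f k ≡ spread p r g k
  go zero    e zero    = at e 0
  go zero    e (suc k) = go p (pointwise λ j → at e (suc j)) k
  go (suc r) e zero    = refl
  go (suc r) e (suc k) = go r e k

spread-𝟘 : ∀ p r k → spread p r 𝟘 k ≡ 0ℤ
spread-𝟘 p zero    zero    = refl
spread-𝟘 p zero    (suc k) = spread-𝟘 p p k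
spread-𝟘 p (suc r) zero    = refl
spread-𝟘 p (suc r) (suc k) = spread-𝟘 p r k

spread-⊕ : ∀ p r f g k → spread p r (f ⊕ g) k ≡ spread p r f k ℤ.+ spread p r g k
spread-⊕ p zero    f g zero    = refl
spread-⊕ p zero    f g (suc k) = spread-⊕ p p (tail f) (tail g) k
spread-⊕ p (suc r) f g zero    = refl
spread-⊕ p (suc r) f g (suc k) = spread-⊕ p r f g k

spread-⊖ : ∀ p r f k → spread p r (⊖ f) k ≡ ℤ.- spread p r f k
spread-⊖ p zero    f zero    = refl
spread-⊖ p zero    f (suc k) = spread-⊖ p p (tail f) k
spread-⊖ p (suc r) f zero    = refl
spread-⊖ p (suc r) f (suc k) = spread-⊖ p r f k

spread-scale : ∀ p r x f k → spread p r (scale x f) k ≡ x ℤ.* spread p r f k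
spread-scale p zero    x f zero    = refl
spread-scale p zero    x f (suc k) = spread-scale p p x (tail f) k
spread-scale p (suc r) x f zero    = sym (ℤₚ.*-zeroʳ x)
spread-scale p (suc r) x f (suc k) = spread-scale p r x f k

spread-⊙ : ∀ p r f g k → spread p r (f ⊙ g) k ≡ (spread p r f ⊙ spread p 0 g) k
spread-⊙ p zero    f g zero    = refl
spread-⊙ p zero    f g (suc k) = begin
  spread p p (tail (f ⊙ g)) k
    ≡⟨ spread-⊕ p p (scale (f 0) (tail g)) (tail f ⊙ g) k ⟩
  spread p p (scale (f 0) (tail g)) k ℤ.+ spread p p (tail f ⊙ g) k
    ≡⟨ cong₂ ℤ._+_ (spread-scale p p (f 0) (tail g) k) (spread-⊙ p p (tail f) g k) ⟩
  f 0 ℤ.* spread p p (tail g) k ℤ.+ (spread p p (tail f) ⊙ spread p 0 g) k ∎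
  where open ≡-Reasoning
spread-⊙ p (suc r) f g zero    = sym (ℤₚ.*-zeroˡ (g 0))
spread-⊙ p (suc r) f g (suc k) = trans (spread-⊙ p r f g k)
  (sym (trans (cong (ℤ._+ (spread p r f ⊙ spread p 0 g) k) (ℤₚ.*-zeroˡ (spread p 0 g (suc k)))) (ℤₚ.+-identityˡ _)))

spread-shift : ∀ p r f → spread p r f ≈ X^ r ⊙ spread p 0 f
spread-shift p zero    f = ≈-sym (⊙-identityˡ _)
spread-shift p (suc r) f = pointwise λ where
  zero    → sym (ℤₚ.*-zeroˡ (f 0))
  (suc k) → trans (at (spread-shift p r f) k)
    (sym (trans (cong (ℤ._+ (X^ r ⊙ spread p 0 f) k) (ℤₚ.*-zeroˡ (spread p 0 f (suc k)))) (ℤₚ.+-identityˡ _)))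

spread-X^ : ∀ p r n k → spread p r (X^ n) k ≡ X^ (r + n * suc p) k
spread-X^ p zero    zero    zero    = refl
spread-X^ p zero    zero    (suc k) = spread-𝟘 p p k
spread-X^ p zero    (suc n) zero    = refl
spread-X^ p zero    (suc n) (suc k) = spread-X^ p p n k
spread-X^ p (suc r) n       zero    = refl
spread-X^ p (suc r) n       (suc k) = spread-X^ p r n k

sub-𝟙 : ∀ p → sub p 𝟙 ≈ 𝟙
sub-𝟙 p = pointwise λ k → spread-X^ (pred p) 0 0 k

sub-⊙ : ∀ p f g → sub p (f ⊙ g) ≈ sub p f ⊙ sub p g
sub-⊙ p f g = pointwise (spread-⊙ (pred p) 0 f g)

sub-cong : ∀ p {f g} → f ≈ g → sub p f ≈ sub p g
sub-cong p = spread-cong (pred p) 0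

sub-X^-1 : ∀ p n → 1 ≤ p → sub p (X^-1 n) ≈ X^-1 (n * p)
sub-X^-1 (suc p) n _ = pointwise λ k → trans (spread-⊕ p 0 (X^ n) (⊖ 𝟙) k)
  (cong₂ ℤ._+_ (spread-X^ p 0 n k) (trans (spread-⊖ p 0 𝟙 k) (cong ℤ.-_ (spread-X^ p 0 0 k))))

sub-unfold : ∀ p f → 1 ≤ p → sub p f ≈ const (f 0) ⊕ X^ p ⊙ sub p (tail f)
sub-unfold (suc p) f _ = pointwise λ where
  zero    → sym (trans (cong (ℤ._+_ (f 0)) (ℤₚ.*-zeroˡ (f 1))) (ℤₚ.+-identityʳ (f 0)))
  (suc k) → trans (at (spread-shift p p (tail f)) k) (sym (trans (ℤₚ.+-identityˡ _)
    (trans (cong (ℤ._+ (X^ p ⊙ spread p 0 (tail f)) k) (ℤₚ.*-zeroˡ (spread p 0 (tail f) (suc k)))) (ℤₚ.+-identityˡ _))))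

-- Since deg f < q, the translates of f that make up f(x)·g(x^q) do not overlap.
⊙-sub-coeff : ∀ q f g i l → VanishesFrom q f → l < q → (f ⊙ sub q g) (i * q + l) ≡ f l ℤ.* g i
⊙-sub-coeff q f g i l v l<q = trans (at (expand g) (i * q + l)) (go i {g})
  where
  open ≡-Reasoning
  1≤q : 1 ≤ q
  1≤q = ℕₚ.≤-trans (s≤s z≤n) l<q
  expand : ∀ g → f ⊙ sub q g ≈ const (g 0) ⊙ f ⊕ X^ q ⊙ (f ⊙ sub q (tail g))
  expand g = ≈-trans (⊙-cong ≈-refl (sub-unfold q g 1≤q))
    (solve 4 (λ f c x s → f :* (c :+ x :* s) := c :* f :+ x :* (f :* s)) ≈-refl f (const (g 0)) (X^ q) (sub q (tail g)))
  go : ∀ i {g} → (const (g 0) ⊙ f ⊕ X^ q ⊙ (f ⊙ sub q (tail g))) (i * q + l) ≡ f l ℤ.* g i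
  go zero {g} = trans (cong₂ ℤ._+_ (at (const-⊙ (g 0) f) l) (X^-⊙-< q _ l l<q))
    (trans (ℤₚ.+-identityʳ _) (ℤₚ.*-comm (g 0) (f l)))
  go (suc i) {g} = begin
    (const (g 0) ⊙ f) (q + i * q + l) ℤ.+ (X^ q ⊙ (f ⊙ sub q (tail g))) (q + i * q + l)
      ≡⟨ cong₂ ℤ._+_ (at (const-⊙ (g 0) f) (q + i * q + l)) (cong (X^ q ⊙ (f ⊙ sub q (tail g))) (ℕₚ.+-assoc q (i * q) l)) ⟩
    g 0 ℤ.* f (q + i * q + l) ℤ.+ (X^ q ⊙ (f ⊙ sub q (tail g))) (q + (i * q + l))
      ≡⟨ cong₂ ℤ._+_ (trans (cong (g 0 ℤ.*_) (v (q + i * q + l) (ℕₚ.≤-trans (ℕₚ.m≤m+n q _) (ℕₚ.m≤m+n _ l)))) (ℤₚ.*-zeroʳ (g 0)))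
           (X^-⊙-+ q (f ⊙ sub q (tail g)) (i * q + l)) ⟩
    0ℤ ℤ.+ (f ⊙ sub q (tail g)) (i * q + l)
      ≡⟨ ℤₚ.+-identityˡ _ ⟩
    (f ⊙ sub q (tail g)) (i * q + l)
      ≡⟨ at (expand (tail g)) (i * q + l) ⟩
    (const (g 1) ⊙ f ⊕ X^ q ⊙ (f ⊙ sub q (tail (tail g)))) (i * q + l)
      ≡⟨ go i {tail g} ⟩
    f l ℤ.* g (suc i) ∎

sub-coeff : ∀ q g i → 1 ≤ q → sub q g (i * q) ≡ g i
sub-coeff q g i 1≤q = begin
  sub q g (i * q)                 ≡⟨ at (⊙-identityˡ (sub q g)) (i * q) ⟨
  (𝟙 ⊙ sub q g) (i * q)           ≡⟨ cong (𝟙 ⊙ sub q g) (ℕₚ.+-identityʳ (i * q)) ⟨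
  (𝟙 ⊙ sub q g) (i * q + 0)       ≡⟨ ⊙-sub-coeff q 𝟙 g i 0 (λ { zero l → ⊥-elim (ℕₚ.1+n≰n (ℕₚ.≤-trans 1≤q l)) ; (suc k) _ → refl }) 1≤q ⟩
  1ℤ ℤ.* g i                      ≡⟨ ℤₚ.*-identityˡ (g i) ⟩
  g i                             ∎
  where open ≡-Reasoning

sub-mod : ∀ p f → 1 ≤ p → sub p f ≈[ p + p ] const (f 0) ⊕ const (f 1) ⊙ X^ p
sub-mod p f 1≤p = pointwise< λ k k< → begin
  sub p f k
    ≡⟨ at expand k ⟩
  (const (f 0) ⊕ const (f 1) ⊙ X^ p) k ℤ.+ (X^ (p + p) ⊙ s) k
    ≡⟨ cong (ℤ._+_ ((const (f 0) ⊕ const (f 1) ⊙ X^ p) k)) (X^-⊙-< (p + p) s k k<) ⟩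
  (const (f 0) ⊕ const (f 1) ⊙ X^ p) k ℤ.+ 0ℤ
    ≡⟨ ℤₚ.+-identityʳ _ ⟩
  (const (f 0) ⊕ const (f 1) ⊙ X^ p) k ∎
  where
  open ≡-Reasoning
  s = sub p (tail (tail f))
  expand : sub p f ≈ const (f 0) ⊕ const (f 1) ⊙ X^ p ⊕ X^ (p + p) ⊙ s
  expand = ≈-trans (sub-unfold p f 1≤p) (≈-trans
    (⊕-cong (≈-refl {const (f 0)}) (⊙-cong (≈-refl {X^ p}) (sub-unfold p (tail f) 1≤p))) (≈-trans
    (solve 4 (λ a b x s → a :+ x :* (b :+ x :* s) := a :+ b :* x :+ (x :* x) :* s) ≈-refl (const (f 0)) (const (f 1)) (X^ p) s)
    (⊕-cong (≈-refl {const (f 0) ⊕ const (f 1) ⊙ X^ p}) (⊙-cong (X^-+ p p) ≈-refl))))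

-- Φ_n(x^p) in terms of Φ_n and Φ_np

Π-cong : ∀ n {F G : ℕ → Series} → (∀ d → 1 ≤ d → F d ≈ G d) → Π n F ≈ Π n G
Π-cong zero    e = ≈-refl
Π-cong (suc n) e = ⊙-cong (e (suc n) (s≤s z≤n)) (Π-cong n e)

Π-⊙ : ∀ n (F G : ℕ → Series) → Π n (λ d → F d ⊙ G d) ≈ Π n F ⊙ Π n G
Π-⊙ zero    F G = ≈-sym (⊙-identityˡ 𝟙)
Π-⊙ (suc n) F G = ≈-trans (⊙-cong ≈-refl (Π-⊙ n F G))
  (solve 4 (λ a b c d → (a :* b) :* (c :* d) := (a :* c) :* (b :* d)) ≈-refl (F (suc n)) (G (suc n)) (Π n F) (Π n G))

Π-sub : ∀ p n F → sub p (Π n F) ≈ Π n (λ d → sub p (F d))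
Π-sub p zero    F = sub-𝟙 p
Π-sub p (suc n) F = ≈-trans (sub-⊙ p (F (suc n)) (Π n F)) (⊙-cong ≈-refl (Π-sub p n F))

select-⊙ : ∀ {P} (P? : Dec P) f g → select P? (f ⊙ g) ≈ select P? f ⊙ select P? g
select-⊙ (yes _) f g = ≈-refl
select-⊙ (no _)  f g = ≈-sym (⊙-identityˡ 𝟙)

select-sub : ∀ {P} (P? : Dec P) p f → sub p (select P? f) ≈ select P? (sub p f)
select-sub (yes _) p f = ≈-refl
select-sub (no _)  p f = sub-𝟙 p

select-⇔ : ∀ {P Q} (P? : Dec P) (Q? : Dec Q) f → (P → Q) → (Q → P) → select P? f ≈ select Q? f
select-⇔ (yes _) (yes _) f to from = ≈-refl
select-⇔ (yes p) (no ¬q) f to from = ⊥-elim (¬q (to p))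
select-⇔ (no ¬p) (yes q) f to from = ⊥-elim (¬p (from q))
select-⇔ (no _)  (no _)  f to from = ≈-refl

select-split : ∀ {P} (P? : Dec P) f → f ≈ select P? f ⊙ select (¬? P?) f
select-split (yes _) f = ≈-trans (≈-sym (⊙-identityˡ f)) (⊙-comm 𝟙 f)
select-split (no _)  f = ≈-sym (⊙-identityˡ f)

Π-multiples : ∀ p n (H : ℕ → Series) → 1 ≤ p → Π (n * p) (λ D → select (p ∣? D) (H D)) ≈ Π n (λ d → H (d * p))
Π-multiples (suc p) zero    H _ = ≈-refl
Π-multiples (suc p) (suc n) H 1≤p = ⊙-cong
  (≈-reflexive (select-yes (suc p ∣? suc n * suc p) _ (n∣m*n (suc n))))
  (≈-trans (skip p ℕₚ.≤-refl) (Π-multiples (suc p) n H 1≤p))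
  where
  F = λ D → select (suc p ∣? D) (H D)
  skip : ∀ j → j ≤ p → Π (j + n * suc p) F ≈ Π (n * suc p) F
  skip zero    _   = ≈-refl
  skip (suc j) j<p = ≈-trans (⊙-cong (≈-reflexive (select-no (suc p ∣? suc j + n * suc p) _
      (λ div → ℕₚ.1+n≰n (ℕₚ.≤-trans (∣⇒≤ (∣m+n∣m⇒∣n (subst (suc p ∣_) (ℕₚ.+-comm (suc j) (n * suc p)) div) (n∣m*n n))) j<p)))) ≈-refl)
    (≈-trans (⊙-identityˡ _) (skip j (ℕₚ.<⇒≤ j<p)))

-- Stands in for Möbius inversion: by strong induction the products over proper divisors agree, and
-- as units they cancel.
divisorProduct-injective : ∀ {α β : ℕ → Series} → (∀ n → 1 ≤ n → IsUnit (α n)) →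
  (∀ n → 1 ≤ n → divisorProduct n n α ≈ divisorProduct n n β) → ∀ n → 1 ≤ n → α n ≈ β n
divisorProduct-injective {α} {β} unit eq n 1≤n = below (suc n) n 1≤n ℕₚ.≤-refl
  where
  products : ∀ N j → (∀ d → 1 ≤ d → d < suc j → α d ≈ β d) → divisorProduct N j α ≈ divisorProduct N j β
  products N zero    h = ≈-refl
  products N (suc j) h with suc j ∣? N
  ... | yes _ = ⊙-cong (h (suc j) (s≤s z≤n) ℕₚ.≤-refl) (products N j (λ d l l′ → h d l (ℕₚ.m≤n⇒m≤1+n l′)))
  ... | no _  = ⊙-cong ≈-refl (products N j (λ d l l′ → h d l (ℕₚ.m≤n⇒m≤1+n l′)))
  units : ∀ N j → IsUnit (divisorProduct N j α)
  units N zero    = unit-𝟙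
  units N (suc j) with suc j ∣? N
  ... | yes _ = unit-⊙ (α (suc j)) (divisorProduct N j α) (unit (suc j) (s≤s z≤n)) (units N j)
  ... | no _  = unit-⊙ 𝟙 (divisorProduct N j α) unit-𝟙 (units N j)
  below : ∀ N d → 1 ≤ d → d < N → α d ≈ β d
  below (suc N) d 1≤d (s≤s d≤N) with ℕₚ.m≤n⇒m<n∨m≡n d≤N
  ... | inj₁ d<N = below N d 1≤d d<N
  below (suc (suc N)) (suc .N) 1≤d (s≤s d≤N) | inj₂ refl = ⊙-cancelʳ (divisorProduct (suc N) N α) (units (suc N) N)
    (≈-trans (≈-sym (divisorProduct-self N α)) (≈-trans (eq (suc N) 1≤d) (≈-trans (divisorProduct-self N β)
      (⊙-cong ≈-refl (≈-sym (products (suc N) N (below (suc N))))))))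

prime-positive : ∀ {p} → Prime p → 1 ≤ p
prime-positive {zero}  pr = ⊥-elim (¬prime[0] pr)
prime-positive {suc p} pr = s≤s z≤n

prime∤⇒coprime : ∀ {p D} → Prime p → p ∤ D → Coprime D p
prime∤⇒coprime pr p∤D (i∣D , i∣p) with prime⇒irreducible pr i∣p
... | inj₁ i≡1  = i≡1
... | inj₂ refl = ⊥-elim (p∤D i∣D)

-- Both sides have the divisor product x^(np) - 1. Among the divisors of np, the multiples of p are
-- the dp with d ∣ n, and those prime to p are the divisors of n prime to p. The `select` treats p ∣
-- n and p ∤ n at once, so that the inversion over all n applies.
φ-sub : ∀ {p} → Prime p → ∀ n → 1 ≤ n → φ (n * p) ⊙ select (¬? (p ∣? n)) (φ n) ≈ sub p (φ n)
φ-sub {p} pr n 1≤n = ≈-sym (divisorProduct-injective (λ n 1≤n → φ-unit n 1≤n (allGood n 1≤n)) products n 1≤n)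
  where
  open ≈-Reasoning
  1≤p = prime-positive pr
  instance _ = prime⇒nonZero pr
  products : ∀ n → 1 ≤ n → divisorProduct n n (λ d → sub p (φ d))
                         ≈ divisorProduct n n (λ d → φ (d * p) ⊙ select (¬? (p ∣? d)) (φ d))
  products n 1≤n = begin
    divisorProduct n n (λ d → sub p (φ d))
      ≈⟨ Π-cong n (λ d _ → select-sub (d ∣? n) p (φ d)) ⟨
    Π n (λ d → sub p (select (d ∣? n) (φ d)))
      ≈⟨ Π-sub p n (λ d → select (d ∣? n) (φ d)) ⟨
    sub p (divisorProduct n n φ)
      ≈⟨ sub-cong p (Good.Φ-product (allGood n 1≤n)) ⟩
    sub p (X^-1 n)
      ≈⟨ sub-X^-1 p n 1≤p ⟩
    X^-1 (n * p)
      ≈⟨ Good.Φ-product (allGood (n * p) (ℕₚ.*-mono-≤ 1≤n 1≤p)) ⟨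
    Π (n * p) (λ D → H D)
      ≈⟨ Π-cong (n * p) (λ D _ → select-split (p ∣? D) (H D)) ⟩
    Π (n * p) (λ D → select (p ∣? D) (H D) ⊙ select (¬? (p ∣? D)) (H D))
      ≈⟨ Π-⊙ (n * p) _ _ ⟩
    Π (n * p) (λ D → select (p ∣? D) (H D)) ⊙ Π (n * p) (λ D → select (¬? (p ∣? D)) (H D))
      ≈⟨ ⊙-cong (Π-multiples p n H 1≤p) (Π-cong (n * p) λ D _ → coprimePart D) ⟩
    Π n (λ d → H (d * p)) ⊙ divisorProduct n (n * p) (λ d → select (¬? (p ∣? d)) (φ d))
      ≈⟨ ⊙-cong (Π-cong n λ d _ → select-⇔ (d * p ∣? n * p) (d ∣? n) (φ (d * p)) (*-cancelʳ-∣ p) (*-monoˡ-∣ p))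
           (divisorProduct-stable n (n * p) _ 1≤n (ℕₚ.m≤m*n n p)) ⟩
    Π n (λ d → select (d ∣? n) (φ (d * p))) ⊙ divisorProduct n n (λ d → select (¬? (p ∣? d)) (φ d))
      ≈⟨ Π-⊙ n _ _ ⟨
    Π n (λ d → select (d ∣? n) (φ (d * p)) ⊙ select (d ∣? n) (select (¬? (p ∣? d)) (φ d)))
      ≈⟨ Π-cong n (λ d _ → select-⊙ (d ∣? n) (φ (d * p)) (select (¬? (p ∣? d)) (φ d))) ⟨
    divisorProduct n n (λ d → φ (d * p) ⊙ select (¬? (p ∣? d)) (φ d)) ∎
    where
    H : ℕ → Series
    H D = select (D ∣? n * p) (φ D)
    coprimePart : ∀ D → select (¬? (p ∣? D)) (H D) ≈ select (D ∣? n) (select (¬? (p ∣? D)) (φ D))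
    coprimePart D with p ∣? D
    ... | yes _  = trivial (D ∣? n)
      where
      trivial : ∀ {P} (P? : Dec P) → 𝟙 ≈ select P? 𝟙
      trivial (yes _) = ≈-refl
      trivial (no _)  = ≈-refl
    ... | no p∤D = select-⇔ (D ∣? n * p) (D ∣? n) (φ D)
      (λ div → coprime-divisor (prime∤⇒coprime pr p∤D) (subst (D ∣_) (ℕₚ.*-comm n p) div))
      (λ div → ∣-trans div (m∣m*n p))

φ-prime-∤ : ∀ {p} n → Prime p → 1 ≤ n → p ∤ n → φ (n * p) ⊙ φ n ≈ sub p (φ n)
φ-prime-∤ {p} n pr 1≤n p∤n = ≈-trans (⊙-cong ≈-refl (≈-reflexive (sym (select-yes (¬? (p ∣? n)) (φ n) p∤n)))) (φ-sub pr n 1≤n)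

φ-prime-∣ : ∀ {p} n → Prime p → 1 ≤ n → p ∣ n → φ (n * p) ≈ sub p (φ n)
φ-prime-∣ {p} n pr 1≤n p∣n = ≈-trans (≈-trans (≈-sym (⊙-identityˡ _)) (⊙-comm 𝟙 _))
  (≈-trans (⊙-cong ≈-refl (≈-reflexive (sym (select-no (¬? (p ∣? n)) (φ n) (λ p∤n → p∤n p∣n))))) (φ-sub pr n 1≤n))

-- Clusters of primes in a residue class

n<2^n : ∀ n → n < 2 ^ n
n<2^n zero    = s≤s z≤n
n<2^n (suc n) = begin-strict
  suc n            ≤⟨ n<2^n n ⟩
  2 ^ n            <⟨ ℕₚ.m<m+n (2 ^ n) (ℕₚ.m^n>0 2 n) ⟩
  2 ^ n + 2 ^ n    ≡⟨ cong (_+_ (2 ^ n)) (ℕₚ.+-identityʳ (2 ^ n)) ⟨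
  2 ^ suc n        ∎
  where open ℕₚ.≤-Reasoning

prime-divisor : ∀ n → 2 ≤ n → ∃ λ p → Prime p × p ∣ n
prime-divisor n@(suc _) 2≤n with factorise n
... | record { factors = [] ; isFactorisation = n≡1 } = ⊥-elim (ℕₚ.1+n≰n (subst (2 ≤_) n≡1 2≤n))
... | record { factors = p ∷ ps ; isFactorisation = n≡ ; factorsPrime = pr ∷ _ } =
  p , pr , subst (p ∣_) (sym n≡) (m∣m*n _)

covering-length : ∀ N (xs : List ℕ) → (∀ n → 1 ≤ n → n ≤ N → n ∈ xs) → N ≤ length xs
covering-length N xs cover = Finₚ.injective⇒≤ {f = λ i → index (mem i)} λ {i} {j} eq →
  Finₚ.toℕ-injective (ℕₚ.suc-injective (index-injective (setoid ℕ) (mem i) (mem j) eq))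
  where
  mem : (i : Fin N) → suc (toℕ i) ∈ xs
  mem i = cover (suc (toℕ i)) (s≤s z≤n) (Finₚ.toℕ<n i)

length-concatMap : ∀ {A B : Set} (f : A → List B) b xs → (∀ x → x ∈ xs → length (f x) ≤ b) →
                   length (concatMap f xs) ≤ length xs * b
length-concatMap f b []       h = z≤n
length-concatMap f b (x ∷ xs) h = subst (_≤ b + length xs * b) (sym (Listₚ.length-++ (f x)))
  (ℕₚ.+-mono-≤ (h x (here refl)) (length-concatMap f b xs (λ y y∈ → h y (there y∈))))

-- A list containing every n ≤ 2^k all of whose prime factors are at most y + 1.
smooth : ℕ → ℕ → List ℕ
smooth zero    k       = [ 1 ]
smooth (suc y) zero    = [ 1 ]
smooth (suc y) (suc k) = smooth y (suc k) ++ map ((2 + y) *_) (smooth (suc y) k)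

-- Every entry is a product of at most k factors from 2, ..., y + 1, and there are (k + 1)^y
-- exponent vectors with entries at most k.
length-smooth : ∀ y k → length (smooth y k) ≤ suc k ^ y
length-smooth zero    k       = s≤s z≤n
length-smooth (suc y) zero    = ℕₚ.m^n>0 1 (suc y)
length-smooth (suc y) (suc k) = begin
  length (smooth y (suc k) ++ map ((2 + y) *_) (smooth (suc y) k))
    ≡⟨ Listₚ.length-++ (smooth y (suc k)) ⟩
  length (smooth y (suc k)) + length (map ((2 + y) *_) (smooth (suc y) k))
    ≡⟨ cong (_+_ (length (smooth y (suc k)))) (Listₚ.length-map ((2 + y) *_) (smooth (suc y) k)) ⟩
  length (smooth y (suc k)) + length (smooth (suc y) k)
    ≤⟨ ℕₚ.+-mono-≤ (length-smooth y (suc k)) (length-smooth (suc y) k) ⟩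
  (2 + k) ^ y + suc k * suc k ^ y
    ≤⟨ ℕₚ.+-monoʳ-≤ ((2 + k) ^ y) (ℕₚ.*-monoʳ-≤ (suc k) (ℕₚ.^-monoˡ-≤ y (ℕₚ.n≤1+n (suc k)))) ⟩
  (2 + k) ^ suc y ∎
  where open ℕₚ.≤-Reasoning

-- The number 2 + y need not be prime: if it divides n, the cofactor is at most n/2; if not, no
-- prime factor of n equals it.
∈-smooth : ∀ y k n → 1 ≤ n → n ≤ 2 ^ k → (∀ p → Prime p → p ∣ n → p < 2 + y) → n ∈ smooth y k
∈-smooth zero    k n 1≤n n≤ small with ℕₚ.m≤n⇒m<n∨m≡n 1≤n
... | inj₂ refl = here refl
... | inj₁ 2≤n with prime-divisor n 2≤n
...   | zero , pr , _ = ⊥-elim (¬prime[0] pr)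
...   | suc zero , pr , _ = ⊥-elim (¬prime[1] pr)
...   | suc (suc p) , pr , p∣n = ⊥-elim (ℕₚ.1+n≰n (ℕₚ.≤-trans (small _ pr p∣n) (s≤s (s≤s z≤n))))
∈-smooth (suc y) zero n 1≤n n≤ small = here (ℕₚ.≤-antisym n≤ 1≤n)
∈-smooth (suc y) (suc k) n 1≤n n≤ small with (2 + y) ∣? n
... | no y∤n = ∈-++⁺ˡ (∈-smooth y (suc k) n 1≤n n≤ λ p pr p∣n →
        ℕₚ.≤∧≢⇒< (ℕₚ.≤-pred (small p pr p∣n)) λ p≡ → y∤n (subst (_∣ n) p≡ p∣n))
... | yes (divides m n≡) = ∈-++⁺ʳ (smooth y (suc k)) (subst (_∈ _) (sym n≡′)
        (∈-map⁺ ((2 + y) *_) (∈-smooth (suc y) k m 1≤m m≤ λ p pr p∣m → small p pr (∣-trans p∣m m∣n))))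
  where
  n≡′ : n ≡ (2 + y) * m
  n≡′ = trans n≡ (ℕₚ.*-comm m (2 + y))
  m∣n : m ∣ n
  m∣n = divides (2 + y) n≡′
  1≤m : 1 ≤ m
  1≤m = ℕₚ.n≢0⇒n>0 λ { refl → ℕₚ.1+n≰n (subst (1 ≤_) n≡ 1≤n) }
  m≤ : m ≤ 2 ^ k
  m≤ = ℕₚ.*-cancelˡ-≤ 2 (ℕₚ.≤-trans (ℕₚ.*-monoˡ-≤ m (s≤s (s≤s (z≤n {y})))) (ℕₚ.≤-trans (ℕₚ.≤-reflexive (sym n≡′)) n≤))

-- With k = 2^s this makes (2k)^y = 2^((s+1)y) smaller than 2^(k-1), half of the range to be
-- covered. The left side is below 16(y + 1)², and y + 1 ≤ 2^y.
growth : ∀ y s → s ≡ 4 + (y + y) → 2 + suc s * y ≤ 2 ^ s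
growth y s refl = begin
  2 + suc (4 + (y + y)) * y                            ≤⟨ ℕₚ.m≤m+n _ (14 + 27 * y + 14 * (y * y)) ⟩
  2 + suc (4 + (y + y)) * y + (14 + 27 * y + 14 * (y * y)) ≡⟨ expand y ⟩
  16 * (suc y * suc y)                                 ≤⟨ ℕₚ.*-monoʳ-≤ 16 (ℕₚ.*-mono-≤ (n<2^n y) (n<2^n y)) ⟩
  16 * (2 ^ y * 2 ^ y)                                 ≡⟨ cong (16 *_) (ℕₚ.^-distribˡ-+-* 2 y y) ⟨
  16 * 2 ^ (y + y)                                     ≡⟨ ℕₚ.^-distribˡ-+-* 2 4 (y + y) ⟨
  2 ^ (4 + (y + y))                                    ∎
  where
  open ℕₚ.≤-Reasoning
  expand : ∀ y → 2 + suc (4 + (y + y)) * y + (14 + 27 * y + 14 * (y * y)) ≡ 16 * (suc y * suc y)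
  expand = solveℕ-∀

module _ (M : ℕ) .{{_ : NonZero M}} where

  -- Only the interval (P, 2P] is searched. It is listed downwards, so that the head of a cluster is
  -- its largest prime.
  primesInClass : ℕ → ℕ → List ℕ
  primesInClass P r = filter (λ p → p % M ℕₚ.≟ r) (filter prime? (applyDownFrom (λ i → suc (P + i)) P))

  ∈-primesInClass : ∀ {P p} → Prime p → P < p → p ≤ P + P → p ∈ primesInClass P (p % M)
  ∈-primesInClass {P} {p} pr P<p p≤ = ∈-filter⁺ (λ p′ → p′ % M ℕₚ.≟ p % M)
    (∈-filter⁺ prime? (Anyₚ.applyDownFrom⁺ (λ i → suc (P + i)) {i = p ∸ suc P} (sym (ℕₚ.m+[n∸m]≡n P<p)) bound) pr) refl
    where
    bound : p ∸ suc P < P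
    bound = ℕₚ.+-cancelˡ-< (suc P) _ _ (subst (_< suc P + P) (sym (ℕₚ.m+[n∸m]≡n P<p)) (s≤s p≤))

  all-primesInClass : ∀ P r → All (λ p → Prime p × P < p × p ≤ P + P × p % M ≡ r) (primesInClass P r)
  all-primesInClass P r = All.zipWith (λ ((pr , l , u) , e) → pr , l , u , e)
    (Allₚ.filter⁺ inClass? (All.zip (Allₚ.all-filter prime? block , Allₚ.filter⁺ prime? bounds)) , Allₚ.all-filter inClass? (filter prime? block))
    where
    inClass? = λ p → p % M ℕₚ.≟ r
    block = applyDownFrom (λ i → suc (P + i)) P
    bounds : All (λ p → P < p × p ≤ P + P) block
    bounds = Allₚ.applyDownFrom⁺₁ (λ i → suc (P + i)) P λ {i} i<P →
      s≤s (ℕₚ.m≤m+n P i) , ℕₚ.≤-trans (ℕₚ.≤-reflexive (sym (ℕₚ.+-suc P i))) (ℕₚ.+-monoʳ-≤ P i<P)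

  primesInClass-descending : ∀ P r → AllPairs _>_ (primesInClass P r)
  primesInClass-descending P r = AllPairsₚ.filter⁺ (λ p → p % M ℕₚ.≟ r) (AllPairsₚ.filter⁺ prime?
    (AllPairsₚ.applyDownFrom⁺₁ (λ i → suc (P + i)) P (λ j<i _ → s≤s (ℕₚ.+-monoʳ-< P j<i))))

  -- If a prime p > 2^(k-e) divides a positive number up to 2^k, the cofactor is below 2^e; thus
  -- each prime of the block just above 2^(k-e) costs 2^e entries.
  multiples : ℕ → ℕ → ℕ → List ℕ
  multiples k e r = concatMap (λ p → map (p *_) (upTo (2 ^ e))) (primesInClass (2 ^ (k ∸ e)) r)

  rough : ℕ → ℕ → List ℕ
  rough k zero    = []
  rough k (suc e) = concatMap (multiples k (suc e)) (upTo M) ++ rough k e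

  -- Block e has at most M·t primes with 2^e multiples each, and 2 + 4 + ... + 2^e < 2^(e+1).
  length-rough : ∀ t k E → (∀ e → e < E → ∀ r → r < M → length (primesInClass (2 ^ (k ∸ suc e)) r) ≤ t) →
                 ∀ e → e ≤ E → length (rough k e) ≤ M * t * 2 ^ suc e
  length-rough t k E few zero    _   = z≤n
  length-rough t k E few (suc e) e<E = begin
    length (rough k (suc e))
      ≡⟨ Listₚ.length-++ (concatMap (multiples k (suc e)) (upTo M)) ⟩
    length (concatMap (multiples k (suc e)) (upTo M)) + length (rough k e)
      ≤⟨ ℕₚ.+-mono-≤ (length-concatMap (multiples k (suc e)) (t * 2 ^ suc e) (upTo M) block) (length-rough t k E few e (ℕₚ.<⇒≤ e<E)) ⟩
    length (upTo M) * (t * 2 ^ suc e) + M * t * 2 ^ suc e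
      ≡⟨ cong (λ n → n * (t * 2 ^ suc e) + M * t * 2 ^ suc e) (Listₚ.length-upTo M) ⟩
    M * (t * 2 ^ suc e) + M * t * 2 ^ suc e
      ≡⟨ double M t (2 ^ suc e) ⟩
    M * t * 2 ^ suc (suc e) ∎
    where
    open ℕₚ.≤-Reasoning
    double : ∀ M t x → M * (t * x) + M * t * x ≡ M * t * (2 * x)
    double = solveℕ-∀
    block : ∀ r → r ∈ upTo M → length (multiples k (suc e) r) ≤ t * 2 ^ suc e
    block r r∈ = ℕₚ.≤-trans
      (length-concatMap _ (2 ^ suc e) (primesInClass (2 ^ (k ∸ suc e)) r) λ p _ →
        ℕₚ.≤-reflexive (trans (Listₚ.length-map (p *_) (upTo (2 ^ suc e))) (Listₚ.length-upTo (2 ^ suc e))))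
      (ℕₚ.*-monoˡ-≤ (2 ^ suc e) (few e e<E r (∈-upTo⁻ r∈)))

  ∈-rough : ∀ k e {p} s → e ≤ k → Prime p → 2 ^ (k ∸ e) < p → p * s ≤ 2 ^ k → 1 ≤ s → p * s ∈ rough k e
  ∈-rough k zero    {p} s e≤k pr lower upper 1≤s = ⊥-elim (ℕₚ.1+n≰n (ℕₚ.≤-trans lower
    (ℕₚ.≤-trans (ℕₚ.m≤m*n p s {{>-nonZero 1≤s}}) upper)))
  ∈-rough k (suc e) {p} s e≤k pr lower upper 1≤s with p ≤? 2 ^ (k ∸ e)
  ... | no p≰ = ∈-++⁺ʳ _ (∈-rough k e s (ℕₚ.<⇒≤ e≤k) pr (ℕₚ.≰⇒> p≰) upper 1≤s)
  ... | yes p≤ = ∈-++⁺ˡ (∈-concatMap⁺ (multiples k (suc e)) (lose (∈-upTo⁺ (m%n<n p M))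
      (∈-concatMap⁺ (λ p → map (p *_) (upTo (2 ^ suc e))) (lose (∈-primesInClass pr lower p≤′) (∈-map⁺ (p *_) (∈-upTo⁺ s<))))))
    where
    i = k ∸ suc e
    p≤′ : p ≤ 2 ^ i + 2 ^ i
    p≤′ = ℕₚ.≤-trans p≤ (ℕₚ.≤-reflexive (trans (cong (2 ^_) (ℕₚ.+-∸-assoc 1 e≤k)) (cong (_+_ (2 ^ i)) (ℕₚ.+-identityʳ (2 ^ i)))))
    s< : s < 2 ^ suc e
    s< = ℕₚ.*-cancelʳ-< (2 ^ i) _ _ (begin-strict
      s * 2 ^ i                  ≡⟨ ℕₚ.*-comm s (2 ^ i) ⟩
      2 ^ i * s                  <⟨ ℕₚ.*-monoˡ-< s {{>-nonZero 1≤s}} lower ⟩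
      p * s                      ≤⟨ upper ⟩
      2 ^ k                      ≡⟨ cong (2 ^_) (ℕₚ.m+[n∸m]≡n e≤k) ⟨
      2 ^ (suc e + i)            ≡⟨ ℕₚ.^-distribˡ-+-* 2 (suc e) i ⟩
      2 ^ suc e * 2 ^ i          ∎)
      where open ℕₚ.≤-Reasoning

  -- Erdős: if every dyadic block up to 2^k had few primes, then the multiples of the primes above 2^j
  -- together with the 2^j-smooth numbers would be too few to exhaust 1, …, 2^k.
  few-primes-impossible : ∀ t j s → 4 * (M * t) ≤ 2 ^ j → s ≡ 4 + (2 ^ j + 2 ^ j) →
    ¬ (∀ i → j ≤ i → i < 2 ^ s → ∀ r → r < M → length (primesInClass (2 ^ i) r) ≤ t)
  few-primes-impossible t j s large s≡ few = ℕₚ.1+n≰n (ℕₚ.≤-trans tooFew (covering-length (2 ^ k) cover covers))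
    where
    y = 2 ^ j
    k = 2 ^ s
    E = k ∸ j
    cover = smooth y k ++ rough k E
    j≤k : j ≤ k
    j≤k = ℕₚ.≤-trans (ℕₚ.<⇒≤ (n<2^n j)) (ℕₚ.≤-trans (ℕₚ.≤-trans (ℕₚ.m≤m+n y y) (ℕₚ.≤-trans (ℕₚ.m≤n+m (y + y) 4) (ℕₚ.≤-reflexive (sym s≡)))) (ℕₚ.<⇒≤ (n<2^n s)))
    k∸E≡j : k ∸ E ≡ j
    k∸E≡j = ℕₚ.m∸[m∸n]≡n j≤k
    1≤k : 1 ≤ k
    1≤k = ℕₚ.m^n>0 2 s
    covers : ∀ n → 1 ≤ n → n ≤ 2 ^ k → n ∈ cover
    covers n 1≤n n≤ with ℕₚ.anyUpTo? (λ p → prime? p ×-dec (p ∣? n) ×-dec (2 + y ≤? p)) (suc n)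
    ... | no none = ∈-++⁺ˡ (∈-smooth y k n 1≤n n≤ λ p pr p∣n → ℕₚ.≰⇒> λ y≤p →
            none (p , s≤s (∣⇒≤ {{>-nonZero 1≤n}} p∣n) , pr , p∣n , y≤p))
    ... | yes (p , _ , pr , divides m n≡ , y≤p) = ∈-++⁺ʳ (smooth y k) (subst (_∈ rough k E) (sym n≡′)
            (∈-rough k E m (ℕₚ.m∸n≤m k j) pr (subst (λ i → 2 ^ i < p) (sym k∸E≡j) (ℕₚ.≤-trans (ℕₚ.n≤1+n (suc y)) y≤p))
              (ℕₚ.≤-trans (ℕₚ.≤-reflexive (sym n≡′)) n≤) 1≤m))
      where
      n≡′ : n ≡ p * m
      n≡′ = trans n≡ (ℕₚ.*-comm m p)
      1≤m : 1 ≤ m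
      1≤m = ℕₚ.n≢0⇒n>0 λ { refl → ℕₚ.1+n≰n (subst (1 ≤_) n≡ 1≤n) }
    few′ : ∀ e → e < E → ∀ r → r < M → length (primesInClass (2 ^ (k ∸ suc e)) r) ≤ t
    few′ e e<E = few (k ∸ suc e) (ℕₚ.≤-trans (ℕₚ.≤-reflexive (sym k∸E≡j)) (ℕₚ.∸-monoʳ-≤ k e<E))
      (ℕₚ.∸-monoʳ-< {k} (s≤s z≤n) (ℕₚ.≤-trans e<E (ℕₚ.m∸n≤m k j)))
    smooth< : length (smooth y k) < 2 ^ pred k
    smooth< = begin-strict
      length (smooth y k)      ≤⟨ length-smooth y k ⟩
      suc k ^ y                ≤⟨ ℕₚ.^-monoˡ-≤ y (begin
        suc k                    ≤⟨ ℕₚ.+-monoˡ-≤ k 1≤k ⟩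
        k + k                    ≡⟨ cong (_+_ k) (ℕₚ.+-identityʳ k) ⟨
        2 ^ suc s                ∎) ⟩
      (2 ^ suc s) ^ y          ≡⟨ ℕₚ.^-*-assoc 2 (suc s) y ⟩
      2 ^ (suc s * y)          <⟨ ℕₚ.^-monoʳ-< 2 (s≤s (s≤s z≤n)) (ℕₚ.pred-mono-≤ (growth y s s≡)) ⟩
      2 ^ pred k               ∎
      where open ℕₚ.≤-Reasoning
    -- By 4Mt ≤ 2^j, the bound M·t·2^(E+1) is at most half of 2^(j+E) = 2^k. The smooth numbers fill
    -- strictly less than the other half.
    rough≤ : length (rough k E) ≤ 2 ^ pred k
    rough≤ = ℕₚ.*-cancelˡ-≤ 2 (begin
      2 * length (rough k E)       ≤⟨ ℕₚ.*-monoʳ-≤ 2 (length-rough t k E few′ E ℕₚ.≤-refl) ⟩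
      2 * (M * t * 2 ^ suc E)      ≡⟨ regroup (M * t) (2 ^ E) ⟩
      4 * (M * t) * 2 ^ E          ≤⟨ ℕₚ.*-monoˡ-≤ (2 ^ E) large ⟩
      2 ^ j * 2 ^ E                ≡⟨ ℕₚ.^-distribˡ-+-* 2 j E ⟨
      2 ^ (j + E)                  ≡⟨ cong (2 ^_) (ℕₚ.m+[n∸m]≡n j≤k) ⟩
      2 ^ k                        ≡⟨ cong (2 ^_) (ℕₚ.suc-pred k {{>-nonZero 1≤k}}) ⟨
      2 * 2 ^ pred k               ∎)
      where
      open ℕₚ.≤-Reasoning
      regroup : ∀ T x → 2 * (T * (2 * x)) ≡ 4 * T * x
      regroup = solveℕ-∀
    tooFew : length cover < 2 ^ k
    tooFew = begin-strict
      length cover                                ≡⟨ Listₚ.length-++ (smooth y k) ⟩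
      length (smooth y k) + length (rough k E)    <⟨ ℕₚ.+-mono-<-≤ smooth< rough≤ ⟩
      2 ^ pred k + 2 ^ pred k                     ≡⟨ cong (_+_ (2 ^ pred k)) (ℕₚ.+-identityʳ (2 ^ pred k)) ⟨
      2 ^ suc (pred k)                            ≡⟨ cong (2 ^_) (ℕₚ.suc-pred k {{>-nonZero 1≤k}}) ⟩
      2 ^ k                                       ∎
      where open ℕₚ.≤-Reasoning

  InCluster : ℕ → ℕ → ℕ → Set
  InCluster P r p = Prime p × P < p × p ≤ P + P × p % M ≡ r

  -- A bounded, hence decidable, search over the scales j ≤ i < 2^s; its failure is what the count
  -- refutes.
  prime-cluster : ∀ t B → ∃ λ P → ∃ λ r → ∃₂ λ p ps →
    B ≤ P × length ps ≡ t × All (InCluster P r) (p ∷ ps) × AllPairs _>_ (p ∷ ps)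
  prime-cluster t B with ℕₚ.anyUpTo? (λ i → (j ≤? i) ×-dec ℕₚ.anyUpTo? (λ r → t <? length (primesInClass (2 ^ i) r)) M) (2 ^ s)
    where
    -- As 2^j > j, the first summand gives 4Mt ≤ 2^j, and the second pushes every block 2^i with i ≥
    -- j beyond B.
    j = 4 * (M * t) + B
    s = 4 + (2 ^ j + 2 ^ j)
  ... | no none = ⊥-elim (few-primes-impossible t _ _ (ℕₚ.≤-trans (ℕₚ.m≤m+n _ B) (ℕₚ.<⇒≤ (n<2^n _))) refl
          λ i j≤i i<k r r<M → ℕₚ.≮⇒≥ λ t< → none (i , i<k , j≤i , r , r<M , t<))
  ... | yes (i , _ , j≤i , r , _ , t<) = extract (primesInClass (2 ^ i) r) t< (all-primesInClass (2 ^ i) r) (primesInClass-descending (2 ^ i) r)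
    where
    B≤ : B ≤ 2 ^ i
    B≤ = ℕₚ.≤-trans (ℕₚ.≤-trans (ℕₚ.m≤n+m B _) j≤i) (ℕₚ.<⇒≤ (n<2^n i))
    extract : ∀ xs → t < length xs → All (InCluster (2 ^ i) r) xs → AllPairs _>_ xs → _
    extract (x ∷ xs) (s≤s t≤) (px ∷ pxs) (gx ∷ gxs) = 2 ^ i , r , x , take t xs , B≤ ,
      trans (Listₚ.length-take t xs) (ℕₚ.m≤n⇒m⊓n≡m t≤) ,
      px ∷ Allₚ.take⁺ t pxs , Allₚ.take⁺ t gx ∷ AllPairsₚ.take⁺ t gxs

-- The case of modulus 1 and t = 0 of the cluster argument.
prime-above : ∀ B → ∃ λ p → Prime p × B < p
prime-above B with prime-cluster 1 0 B
... | P , r , p , ps , B≤P , _ , (pr , P<p , _) ∷ _ , _ = p , pr , ℕₚ.≤-<-trans B≤P P<p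

-- Low coefficients and reciprocals

prime≥2 : ∀ {p} → Prime p → 2 ≤ p
prime≥2 {zero}        pr = ⊥-elim (¬prime[0] pr)
prime≥2 {suc zero}    pr = ⊥-elim (¬prime[1] pr)
prime≥2 {suc (suc p)} pr = s≤s (s≤s z≤n)

>⇒∤ : ∀ {p n} → 1 ≤ n → n < p → p ∤ n
>⇒∤ 1≤n n<p p∣n = ℕₚ.<⇒≱ n<p (∣⇒≤ {{>-nonZero 1≤n}} p∣n)

φ-isUnit : ∀ n → 1 ≤ n → IsUnit (φ n)
φ-isUnit n 1≤n = φ-unit n 1≤n (allGood n 1≤n)

-- If p ∤ m, then Φ_mp(0)·Φ_m(0) = Φ_m(0), and Φ_m(0) = ±1 cancels. This covers m = 1, where it is
-- -1. If p ∣ m, then Φ_mp(0) = Φ_m(0).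
φ-0 : ∀ n → 2 ≤ n → φ n 0 ≡ 1ℤ
φ-0 n 2≤n = go n n ℕₚ.≤-refl 2≤n
  where
  go : ∀ fuel n → n ≤ fuel → 2 ≤ n → φ n 0 ≡ 1ℤ
  go zero       n n≤ 2≤n = ⊥-elim (ℕₚ.1+n≰n (ℕₚ.≤-trans 2≤n (ℕₚ.≤-trans n≤ z≤n)))
  go (suc fuel) n n≤ 2≤n with prime-divisor n 2≤n
  ... | p , pr , divides m refl with p ∣? m
  ...   | yes p∣m = trans (at (φ-prime-∣ m pr 1≤m p∣m) 0) (go fuel m m≤ (ℕₚ.≤-trans (prime≥2 pr) (∣⇒≤ {{>-nonZero 1≤m}} p∣m)))
    where
    1≤m : 1 ≤ m
    1≤m = ℕₚ.n≢0⇒n>0 λ { refl → ℕₚ.1+n≰n (ℕₚ.≤-trans 2≤n z≤n) }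
    m≤ : m ≤ fuel
    m≤ = ℕₚ.≤-pred (ℕₚ.≤-trans (ℕₚ.m<m*n m p {{>-nonZero 1≤m}} (prime≥2 pr)) n≤)
  ...   | no p∤m = begin
    φ (m * p) 0                           ≡⟨ ℤₚ.*-identityʳ _ ⟨
    φ (m * p) 0 ℤ.* 1ℤ                    ≡⟨ cong (φ (m * p) 0 ℤ.*_) (φ-isUnit m 1≤m) ⟨
    φ (m * p) 0 ℤ.* (φ m 0 ℤ.* φ m 0)     ≡⟨ ℤₚ.*-assoc (φ (m * p) 0) _ _ ⟨
    φ (m * p) 0 ℤ.* φ m 0 ℤ.* φ m 0       ≡⟨ cong (ℤ._* φ m 0) (at (φ-prime-∤ m pr 1≤m p∤m) 0) ⟩
    φ m 0 ℤ.* φ m 0                       ≡⟨ φ-isUnit m 1≤m ⟩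
    1ℤ                                    ∎
    where
    open ≡-Reasoning
    1≤m : 1 ≤ m
    1≤m = ℕₚ.n≢0⇒n>0 λ { refl → ℕₚ.1+n≰n (ℕₚ.≤-trans 2≤n z≤n) }

-- Φ_np·Φ_n = Φ_n(x^p) has no linear term, and both factors have constant term 1.
φ-1 : ∀ n {p} → Prime p → 2 ≤ n → p ∤ n → φ (n * p) 1 ≡ ℤ.- φ n 1
φ-1 n {zero}            pr 2≤n p∤n = ⊥-elim (¬prime[0] pr)
φ-1 n {suc zero}        pr 2≤n p∤n = ⊥-elim (¬prime[1] pr)
φ-1 n {p@(suc (suc _))} pr 2≤n p∤n = solve-linear (φ (n * p) 0) (φ n 0)
  (φ-0 (n * p) (ℕₚ.≤-trans 2≤n (ℕₚ.m≤m*n n p))) (φ-0 n 2≤n) (at (φ-prime-∤ n pr (ℕₚ.<⇒≤ 2≤n) p∤n) 1)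
  where
  rearrange : ∀ x y → x ≡ (1ℤ ℤ.* y ℤ.+ x ℤ.* 1ℤ) ℤ.+ ℤ.- y
  rearrange = solve-∀
  solve-linear : ∀ x₀ y₀ {x₁ y₁} → x₀ ≡ 1ℤ → y₀ ≡ 1ℤ → x₀ ℤ.* y₁ ℤ.+ x₁ ℤ.* y₀ ≡ 0ℤ → x₁ ≡ ℤ.- y₁
  solve-linear _ _ {x₁} {y₁} refl refl e = trans (rearrange x₁ y₁)
    (trans (cong (ℤ._+ ℤ.- y₁) e) (ℤₚ.+-identityˡ _))

-- The reciprocal series 1/Φ_n

convSum-⊙ : ∀ n j k → convSum n j (cs n k) ≡ ((λ i → a n (i + j)) ⊙ c n) k
convSum-⊙ n j zero    = ℤₚ.+-identityʳ _
convSum-⊙ n j (suc k) = cong (ℤ._+_ (a n j ℤ.* c n (suc k))) (trans (convSum-⊙ n (suc j) k)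
  (⊙-local (λ i → a n (i + suc j)) (λ i → a n (suc i + j)) (c n) (c n) k
    (λ i _ → cong (a n) (ℕₚ.+-suc i j)) (λ _ _ → refl)))

φ⊙c : ∀ n → 1 ≤ n → φ n ⊙ c n ≈ 𝟙
φ⊙c n 1≤n = pointwise λ { zero → φ-isUnit n 1≤n ; (suc k) → go k }
  where
  open ≡-Reasoning
  regroup : ∀ x s → x ℤ.* (x ℤ.* ℤ.- s) ℤ.+ s ≡ (x ℤ.* x) ℤ.* ℤ.- s ℤ.+ s
  regroup = solve-∀
  cancel : ∀ s → 1ℤ ℤ.* ℤ.- s ℤ.+ s ≡ 0ℤ
  cancel = solve-∀
  go : ∀ k → φ n 0 ℤ.* c n (suc k) ℤ.+ (tail (φ n) ⊙ c n) k ≡ 0ℤ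
  go k = begin
    φ n 0 ℤ.* c n (suc k) ℤ.+ (tail (φ n) ⊙ c n) k
      ≡⟨ cong (ℤ._+_ (φ n 0 ℤ.* c n (suc k))) (trans
           (⊙-local (tail (φ n)) (λ i → a n (i + 1)) (c n) (c n) k (λ i _ → cong (a n) (ℕₚ.+-comm 1 i)) (λ _ _ → refl))
           (sym (convSum-⊙ n 1 k))) ⟩
    φ n 0 ℤ.* (φ n 0 ℤ.* ℤ.- S) ℤ.+ S        ≡⟨ regroup (φ n 0) S ⟩
    φ n 0 ℤ.* φ n 0 ℤ.* ℤ.- S ℤ.+ S          ≡⟨ cong (λ x → x ℤ.* ℤ.- S ℤ.+ S) (φ-isUnit n 1≤n) ⟩
    1ℤ ℤ.* ℤ.- S ℤ.+ S                       ≡⟨ cancel S ⟩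
    0ℤ                                       ∎
    where
    S = convSum n 1 (cs n k)

≈[]-refl : ∀ {L f} → f ≈[ L ] f
≈[]-refl {L} = IsEquivalence.refl (≈[]-isEquivalence L)

≈[]-weaken : ∀ {L L′ f g} → L ≤ L′ → f ≈[ L′ ] g → f ≈[ L ] g
≈[]-weaken L≤ e = pointwise< λ k k< → at< e k (ℕₚ.≤-trans k< L≤)

invert : ∀ {L f h w r} → f ⊙ h ≈[ L ] r → h ⊙ w ≈[ L ] 𝟙 → f ≈[ L ] r ⊙ w
invert {L} {f} {h} {w} {r} e e′ = begin
  f              ≈⟨ ≈⇒≈[] L (solve 1 (λ f → f := f :* con 1ℤ) ≈-refl f) ⟩
  f ⊙ 𝟙          ≈⟨ ⊙-cong< (≈[]-refl {L} {f}) e′ ⟨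
  f ⊙ (h ⊙ w)    ≈⟨ ≈⇒≈[] L (⊙-assoc f h w) ⟨
  (f ⊙ h) ⊙ w    ≈⟨ ⊙-cong< e (≈[]-refl {L} {w}) ⟩
  r ⊙ w          ∎
  where open ≈[]-Reasoning L

-- Modulo x^q, Φ_n(x^q) reduces to its constant term 1: a large new prime inverts Φ_n.
φ-reciprocal : ∀ n {q} → 2 ≤ n → Prime q → q ∤ n → φ (n * q) ⊙ φ n ≈[ q ] 𝟙
φ-reciprocal n {q} 2≤n pr q∤n = pointwise< λ k k< → begin
  (φ (n * q) ⊙ φ n) k                         ≡⟨ at (φ-prime-∤ n pr (ℕₚ.<⇒≤ 2≤n) q∤n) k ⟩
  sub q (φ n) k                               ≡⟨ at (sub-unfold q (φ n) (prime-positive pr)) k ⟩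
  const (φ n 0) k ℤ.+ (X^ q ⊙ sub q (tail (φ n))) k ≡⟨ cong₂ ℤ._+_ (cong (λ x → const x k) (φ-0 n 2≤n)) (X^-⊙-< q _ k k<) ⟩
  𝟙 k ℤ.+ 0ℤ                                  ≡⟨ ℤₚ.+-identityʳ _ ⟩
  𝟙 k                                         ∎
  where open ≡-Reasoning

c≡a : ∀ n {q} → 2 ≤ n → Prime q → q ∤ n → ∀ k → k < q → c (n * q) k ≡ a n k
c≡a n {q} 2≤n pr q∤n k k< = trans (at< (invert
  (≈⇒≈[] q (≈-trans (⊙-comm (c (n * q)) (φ (n * q))) (φ⊙c (n * q) (ℕₚ.*-mono-≤ (ℕₚ.<⇒≤ 2≤n) (prime-positive pr)))))
  (φ-reciprocal n 2≤n pr q∤n)) k k<) (at (⊙-identityˡ (φ n)) k)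

-- (x^n - 1)/Φ_n = R is a polynomial of degree n - deg Φ_n, so (x^n - 1)·(1/Φ_n) vanishes from index
-- n on as soon as deg Φ_n ≥ 1, which a(n,1) ≠ 0 guarantees.
c-periodic : ∀ n → 1 ≤ n → φ n 1 ≢ 0ℤ → ∀ k → c n (n + k) ≡ c n k
c-periodic n@(suc n′) 1≤n φ1≢0 k = sym (ℤₚ.i-j≡0⇒i≡j (c n k) (c n (n + k)) (begin
  c n k ℤ.- c n (n + k)
    ≡⟨ cong₂ (λ x y → x ℤ.+ ℤ.- y) (X^-⊙-+ n (c n) k) (at (⊙-identityˡ (c n)) (n + k)) ⟨
  (X^ n ⊙ c n) (n + k) ℤ.+ ℤ.- (𝟙 ⊙ c n) (n + k)
    ≡⟨ at (≈-sym R≈) (n + k) ⟩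
  R (n + k)
    ≡⟨ R-vanishes (n + k) (ℕₚ.m≤m+n n k) ⟩
  0ℤ ∎))
  where
  open ≡-Reasoning
  R = divisorProduct n n′ φ
  φR : φ n ⊙ R ≈ X^-1 n
  φR = φ⊙rest n′ (allGood n 1≤n)
  R≈ : R ≈ X^ n ⊙ c n ⊕ ⊖ (𝟙 ⊙ c n)
  R≈ = ≈-trans (≈-trans (≈-sym (⊙-identityˡ R)) (⊙-cong (≈-sym (φ⊙c n 1≤n)) ≈-refl))
    (≈-trans (solve 3 (λ f c r → (f :* c) :* r := (f :* r) :* c) ≈-refl (φ n) (c n) R)
    (≈-trans (⊙-cong φR ≈-refl)
      (solve 2 (λ x c → (x :- con 1ℤ) :* c := x :* c :- con 1ℤ :* c) ≈-refl (X^ n) (c n))))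
  R-vanishes : VanishesFrom n R
  R-vanishes with Good.Φ-monic (allGood n 1≤n)
  ... | d , monic len lead with series-degree _ R (proj₂ (divisorProduct-finite n n′))
  ...   | inj₁ R≈0 = λ j _ → at R≈0 j
  ...   | inj₂ (e , Re≢0 , ve) = λ j n≤j → ve j (ℕₚ.≤-trans e<n n≤j)
    where
    vφ : VanishesFrom (suc d) (φ n)
    vφ j l = coeff-vanishes (Φ n) j (ℕₚ.≤-trans (ℕₚ.≤-reflexive len) l)
    1≤d : 1 ≤ d
    1≤d = ℕₚ.n≢0⇒n>0 λ { refl → φ1≢0 (vφ 1 (s≤s z≤n)) }
    top : X^-1 n (d + e) ≡ R e
    top = trans (sym (at φR (d + e))) (trans (⊙-top d e vφ ve) (trans (cong (ℤ._* R e) lead) (ℤₚ.*-identityˡ (R e))))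
    e<n : e < n
    e<n with d + e ℕₚ.≟ n
    ... | yes d+e≡n = ℕₚ.≤-trans (ℕₚ.+-monoˡ-≤ e 1≤d) (ℕₚ.≤-reflexive d+e≡n)
    ... | no d+e≢n = ⊥-elim (Re≢0 (trans (sym top) (cong₂ (λ x y → x ℤ.+ ℤ.- y) (X^-≢ n (d + e) d+e≢n)
            (X^-≢ 0 (d + e) (λ z → ℕₚ.1+n≰n (ℕₚ.≤-trans 1≤d (ℕₚ.≤-trans (ℕₚ.m≤m+n d e) (ℕₚ.≤-reflexive z))))))))

c-periodic* : ∀ n → 1 ≤ n → φ n 1 ≢ 0ℤ → ∀ s k → c n (s * n + k) ≡ c n k
c-periodic* n 1≤n φ1≢0 zero    k = refl
c-periodic* n 1≤n φ1≢0 (suc s) k = trans (cong (c n) (ℕₚ.+-assoc n (s * n) k))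
  (trans (c-periodic n 1≤n φ1≢0 (s * n + k)) (c-periodic* n 1≤n φ1≢0 s k))

-- Adjoining a cluster of primes

module Cluster (M P : ℕ) (2≤M : 2 ≤ M) (M≤P : M ≤ P) (φM1 : φ M 1 ≡ -1ℤ) where

  L = P + P

  index* : List ℕ → ℕ
  index* []       = M
  index* (p ∷ ps) = index* ps * p

  H : List ℕ → Series
  H []       = φ M
  H (p ∷ ps) = (𝟙 ⊕ X^ p) ⊙ H ps

  -- The inverse of `H ps` modulo x^L, because (1 + x^p)(1 - x^p) = 1 - x^(2p) and 2p > L.
  W : List ℕ → Series
  W []       = c M
  W (p ∷ ps) = (𝟙 ⊕ ⊖ X^ p) ⊙ W ps

  -- Since Φ_Np·Φ_N is 1 + a(N,1)x^p modulo x^L, adjoining a prime inverts Φ up to one factor 1 ±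
  -- x^p, whose sign is that of a(N,1); that sign flips as well. So Φ alternates between H and 1/H.
  data State (ps : List ℕ) : Set where
    even : φ (index* ps) 1 ≡ -1ℤ → φ (index* ps) ≈[ L ] H ps → State ps
    odd  : φ (index* ps) 1 ≡ 1ℤ → φ (index* ps) ⊙ H ps ≈[ L ] 𝟙 → State ps

  index*-multiple : ∀ ps → All (λ p → Prime p × P < p) ps → ∃ λ n → 1 ≤ n × index* ps ≡ M * n
  index*-multiple []       []              = 1 , s≤s z≤n , sym (ℕₚ.*-identityʳ M)
  index*-multiple (p ∷ ps) ((pr , _) ∷ h) with index*-multiple ps h
  ... | n , 1≤n , e = n * p , ℕₚ.*-mono-≤ 1≤n (prime-positive pr) , trans (cong (_* p) e) (ℕₚ.*-assoc M n p)

  index*≥2 : ∀ ps → All (λ p → Prime p × P < p) ps → 2 ≤ index* ps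
  index*≥2 ps h with index*-multiple ps h
  ... | n , 1≤n , e = ℕₚ.≤-trans (ℕₚ.*-mono-≤ 2≤M 1≤n) (ℕₚ.≤-reflexive (sym e))

  -- Such a p would have to divide M ≤ P < p or a smaller prime of the list; this is where the
  -- descending order enters.
  ∤index* : ∀ {p} ps → Prime p → P < p → All (_< p) ps → All (λ p → Prime p × P < p) ps → p ∤ index* ps
  ∤index* []       pr P<p []         []                p∣ = >⇒∤ (ℕₚ.<⇒≤ 2≤M) (ℕₚ.≤-<-trans M≤P P<p) p∣
  ∤index* (r ∷ ps) pr P<p (r<p ∷ ls) ((pr′ , _) ∷ h) p∣ with euclidsLemma (index* ps) r pr p∣
  ... | inj₁ p∣N = ∤index* ps pr P<p ls h p∣N
  ... | inj₂ p∣r = >⇒∤ (prime-positive pr′) r<p p∣r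

  difference-of-squares : ∀ p → P < p → (𝟙 ⊕ X^ p) ⊙ (𝟙 ⊕ ⊖ X^ p) ≈[ L ] 𝟙
  difference-of-squares p P<p = pointwise< λ k k< → trans
    (at (≈-trans (solve 1 (λ x → (con 1ℤ :+ x) :* (con 1ℤ :- x) := con 1ℤ :- x :* x) ≈-refl (X^ p))
          (⊕-cong (≈-refl {𝟙}) (⊖-cong (X^-+ p p)))) k)
    (trans (cong (λ y → 𝟙 k ℤ.+ ℤ.- y) (X^-≢ (p + p) k (λ { refl → ℕₚ.<⇒≱ k< (ℕₚ.+-mono-≤ (ℕₚ.<⇒≤ P<p) (ℕₚ.<⇒≤ P<p)) })))
           (ℤₚ.+-identityʳ _))

  φ-adjoin : ∀ N {p b} → 2 ≤ N → Prime p → P < p → p ∤ N → φ N 1 ≡ b → φ (N * p) ⊙ φ N ≈[ L ] 𝟙 ⊕ const b ⊙ X^ p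
  φ-adjoin N {p} {b} 2≤N pr P<p p∤N refl = subst (λ x → φ (N * p) ⊙ φ N ≈[ L ] const x ⊕ const b ⊙ X^ p) (φ-0 N 2≤N)
    (begin
      φ (N * p) ⊙ φ N                 ≈⟨ ≈⇒≈[] L (φ-prime-∤ N pr (ℕₚ.<⇒≤ 2≤N) p∤N) ⟩
      sub p (φ N)                     ≈⟨ ≈[]-weaken (ℕₚ.+-mono-≤ (ℕₚ.<⇒≤ P<p) (ℕₚ.<⇒≤ P<p)) (sub-mod p (φ N) (prime-positive pr)) ⟩
      const (φ N 0) ⊕ const b ⊙ X^ p  ∎)
    where open ≈[]-Reasoning L

  state : ∀ ps → All (λ p → Prime p × P < p) ps → AllPairs _>_ ps → State ps
  state []       []               []       = even φM1 ≈[]-refl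
  state (p ∷ ps) ((pr , P<p) ∷ h) (gs ∷ g) with state ps h g
  ... | even N1 e = odd (trans (φ-1 N pr 2≤N p∤N) (cong ℤ.-_ N1)) (begin
    φ (N * p) ⊙ ((𝟙 ⊕ X^ p) ⊙ H ps)
      ≈⟨ ⊙-cong< (≈[]-refl {f = φ (N * p)}) (⊙-cong< (≈[]-refl {f = 𝟙 ⊕ X^ p}) e) ⟨
    φ (N * p) ⊙ ((𝟙 ⊕ X^ p) ⊙ φ N)
      ≈⟨ ≈⇒≈[] L (solve 3 (λ f x g → f :* (x :* g) := x :* (f :* g)) ≈-refl (φ (N * p)) (𝟙 ⊕ X^ p) (φ N)) ⟩
    (𝟙 ⊕ X^ p) ⊙ (φ (N * p) ⊙ φ N)
      ≈⟨ ⊙-cong< (≈[]-refl {f = 𝟙 ⊕ X^ p}) (φ-adjoin N 2≤N pr P<p p∤N N1) ⟩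
    (𝟙 ⊕ X^ p) ⊙ (𝟙 ⊕ const -1ℤ ⊙ X^ p)
      ≈⟨ ≈⇒≈[] L (solve 1 (λ x → (con 1ℤ :+ x) :* (con 1ℤ :+ con -1ℤ :* x) := (con 1ℤ :+ x) :* (con 1ℤ :- x)) ≈-refl (X^ p)) ⟩
    (𝟙 ⊕ X^ p) ⊙ (𝟙 ⊕ ⊖ X^ p)
      ≈⟨ difference-of-squares p P<p ⟩
    𝟙 ∎)
    where
    open ≈[]-Reasoning L
    N = index* ps
    2≤N = index*≥2 ps h
    p∤N = ∤index* ps pr P<p gs h
  ... | odd N1 e = even (trans (φ-1 N pr 2≤N p∤N) (cong ℤ.-_ N1)) (begin
    φ (N * p)                        ≈⟨ invert (φ-adjoin N 2≤N pr P<p p∤N N1) e ⟩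
    (𝟙 ⊕ const 1ℤ ⊙ X^ p) ⊙ H ps     ≈⟨ ≈⇒≈[] L (solve 2 (λ x h → (con 1ℤ :+ con 1ℤ :* x) :* h := (con 1ℤ :+ x) :* h) ≈-refl (X^ p) (H ps)) ⟩
    (𝟙 ⊕ X^ p) ⊙ H ps                ∎)
    where
    open ≈[]-Reasoning L
    N = index* ps
    2≤N = index*≥2 ps h
    p∤N = ∤index* ps pr P<p gs h

  H⊙W : ∀ ps → All (λ p → Prime p × P < p) ps → H ps ⊙ W ps ≈[ L ] 𝟙
  H⊙W []       []              = ≈⇒≈[] L (φ⊙c M (ℕₚ.<⇒≤ 2≤M))
  H⊙W (p ∷ ps) ((_ , P<p) ∷ h) = begin
    ((𝟙 ⊕ X^ p) ⊙ H ps) ⊙ ((𝟙 ⊕ ⊖ X^ p) ⊙ W ps)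
      ≈⟨ ≈⇒≈[] L (solve 4 (λ x h y w → (x :* h) :* (y :* w) := (x :* y) :* (h :* w)) ≈-refl (𝟙 ⊕ X^ p) (H ps) (𝟙 ⊕ ⊖ X^ p) (W ps)) ⟩
    ((𝟙 ⊕ X^ p) ⊙ (𝟙 ⊕ ⊖ X^ p)) ⊙ (H ps ⊙ W ps)
      ≈⟨ ⊙-cong< (difference-of-squares p P<p) (H⊙W ps h) ⟩
    𝟙 ⊙ 𝟙
      ≈⟨ ≈⇒≈[] L (⊙-identityˡ 𝟙) ⟩
    𝟙 ∎
    where open ≈[]-Reasoning L

  -- When the number of primes is even, one more huge prime inverts φ modulo x^L.
  reciprocal-index : ∀ ps → All (λ p → Prime p × P < p) ps → AllPairs _>_ ps →
    ∃ λ n → 1 ≤ n × φ (M * n) ⊙ H ps ≈[ L ] 𝟙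
  reciprocal-index ps h g with index*-multiple ps h | index*≥2 ps h | state ps h g
  ... | n , 1≤n , e | _   | odd _ o  = n , 1≤n , subst (λ N → φ N ⊙ H ps ≈[ L ] 𝟙) e o
  ... | n , 1≤n , e | 2≤N | even _ v with prime-above (index* ps + L)
  ...   | q , pr , big = n * q , ℕₚ.*-mono-≤ 1≤n (prime-positive pr) ,
    subst (λ N → φ N ⊙ H ps ≈[ L ] 𝟙) (trans (cong (_* q) e) (ℕₚ.*-assoc M n q)) (begin
      φ (N * q) ⊙ H ps   ≈⟨ ⊙-cong< (≈[]-refl {f = φ (N * q)}) v ⟨
      φ (N * q) ⊙ φ N    ≈⟨ ≈[]-weaken (ℕₚ.≤-trans (ℕₚ.m≤n+m L N) (ℕₚ.<⇒≤ big))
                              (φ-reciprocal N 2≤N pr (>⇒∤ (ℕₚ.<⇒≤ 2≤N) (ℕₚ.≤-<-trans (ℕₚ.m≤m+n N L) big))) ⟩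
      𝟙                  ∎)
    where
    open ≈[]-Reasoning L
    N = index* ps

  W-step : ∀ p ps k → W (p ∷ ps) k ≡ W ps k ℤ.+ ℤ.- (X^ p ⊙ W ps) k
  W-step p ps = at (solve 2 (λ x w → (con 1ℤ :- x) :* w := w :- x :* w) ≈-refl (X^ p) (W ps))

  W-low : ∀ ps → All (P <_) ps → ∀ k → k < P → W ps k ≡ c M k
  W-low []       []        k k<P = refl
  W-low (p ∷ ps) (P<p ∷ h) k k<P = trans (W-step p ps k) (trans
    (cong₂ (λ x y → x ℤ.+ ℤ.- y) (W-low ps h k k<P) (X^-⊙-< p (W ps) k (ℕₚ.<-trans k<P P<p))) (ℤₚ.+-identityʳ _))

  -- Two primes above P sum to more than L, so ∏(1 - x^p) is 1 - ∑ x^p modulo x^L and the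
  -- coefficient is c(M,k) - ∑ c(M,k-p). In the induction this appears as k - p < P, where the
  -- remaining factors have no effect.
  W-coeff : ∀ ps k w → k < L → All (P <_) ps → All (λ p → ∃ λ j → k ≡ p + j × c M j ≡ w) ps →
            W ps k ≡ c M k ℤ.- (+ length ps) ℤ.* w
  W-coeff []       k w k<L []        []                  = sym (trans (cong (λ x → c M k ℤ.- x) (ℤₚ.*-zeroˡ w)) (ℤₚ.+-identityʳ (c M k)))
  W-coeff (p ∷ ps) k w k<L (P<p ∷ l) ((j , k≡ , cj) ∷ h) = begin
    W (p ∷ ps) k
      ≡⟨ W-step p ps k ⟩
    W ps k ℤ.+ ℤ.- (X^ p ⊙ W ps) k
      ≡⟨ cong₂ (λ x y → x ℤ.+ ℤ.- y) (W-coeff ps k w k<L l h)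
           (trans (cong (X^ p ⊙ W ps) k≡) (trans (X^-⊙-+ p (W ps) j) (trans (W-low ps l j j<P) cj))) ⟩
    c M k ℤ.- (+ length ps) ℤ.* w ℤ.+ ℤ.- w
      ≡⟨ regroup (c M k) (+ length ps) w ⟩
    c M k ℤ.- (1ℤ ℤ.+ + length ps) ℤ.* w ∎
    where
    open ≡-Reasoning
    regroup : ∀ x n w → x ℤ.+ ℤ.- (n ℤ.* w) ℤ.+ ℤ.- w ≡ x ℤ.+ ℤ.- ((1ℤ ℤ.+ n) ℤ.* w)
    regroup = solve-∀
    j<P : j < P
    j<P = ℕₚ.+-cancelˡ-< P _ _ (ℕₚ.≤-<-trans (ℕₚ.+-monoˡ-≤ j (ℕₚ.<⇒≤ P<p)) (subst (_< L) k≡ k<L))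

  cluster-coeff : ∀ ps k w → k < L → All (λ p → Prime p × P < p) ps → AllPairs _>_ ps →
    All (λ p → ∃ λ j → k ≡ p + j × c M j ≡ w) ps → ∃ λ n → 1 ≤ n × φ (M * n) k ≡ c M k ℤ.- (+ length ps) ℤ.* w
  cluster-coeff ps k w k<L h g eqs with reciprocal-index ps h g
  ... | n , 1≤n , e = n , 1≤n , trans (at< (invert e (H⊙W ps h)) k k<L)
    (trans (at (⊙-identityˡ (W ps)) k) (W-coeff ps k w k<L (All.map proj₂ h) eqs))

-- Realising every integer

congruent⇒difference : ∀ M .{{_ : NonZero M}} {p p′} → p % M ≡ p′ % M → p′ < p → ∃ λ s → p ≡ suc s * M + p′
congruent⇒difference M {p} {p′} e p′<p = s , (begin
  p                                          ≡⟨ m≡m%n+[m/n]*n p M ⟩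
  p % M + p / M * M                          ≡⟨ cong₂ (λ r x → r + x * M) e (sym s≡) ⟩
  p′ % M + (suc s + p′ / M) * M              ≡⟨ regroup (p′ % M) (suc s) (p′ / M) M ⟩
  suc s * M + (p′ % M + p′ / M * M)          ≡⟨ cong (_+_ (suc s * M)) (m≡m%n+[m/n]*n p′ M) ⟨
  suc s * M + p′                             ∎)
  where
  open ≡-Reasoning
  regroup : ∀ r s b M → r + (s + b) * M ≡ s * M + (r + b * M)
  regroup = solveℕ-∀
  quotient< : p′ / M < p / M
  quotient< = ℕₚ.≰⇒> λ a≤b → ℕₚ.<⇒≱ p′<p (ℕₚ.≤-trans (ℕₚ.≤-reflexive (m≡m%n+[m/n]*n p M))
    (ℕₚ.≤-trans (ℕₚ.+-mono-≤ (ℕₚ.≤-reflexive e) (ℕₚ.*-monoˡ-≤ M a≤b)) (ℕₚ.≤-reflexive (sym (m≡m%n+[m/n]*n p′ M)))))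
  s = p / M ∸ suc (p′ / M)
  s≡ : suc s + p′ / M ≡ p / M
  s≡ = trans (sym (ℕₚ.+-suc s (p′ / M))) (ℕₚ.m∸n+n≡m quotient<)

module _ (m : ℕ) (2≤m : 2 ≤ m) (φm1 : φ m 1 ≡ 1ℤ) where

  -- With q a prime above 2 deg Φ_m and M = mq, the coefficient c(M, iq + l) equals a(m,l) c(m,i) for
  -- l < q.  A prime p not divisible by q leaves a remainder p % q such that, with d = deg Φ_m and for
  -- l = 0 or l = d, one has d < l + p % q < q; hence c(M, p + εq + l) = 0 while c(M, εq + l) = c(m,ε).
  realise-multiple : ∀ t ε → ε ≤ 1 → ∃₂ λ n k → 1 ≤ n × φ (m * n) k ≡ 0ℤ ℤ.- (+ t) ℤ.* c m ε
  realise-multiple t ε ε≤1 with Good.Φ-monic (allGood m (ℕₚ.<⇒≤ 2≤m))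
  -- Exceeding m ensures q ∤ m; exceeding 2d leaves room for `offset`.
  ... | d , monic len lead with prime-above (d + d + m)
  ...   | q , q-prime , big = result
    where
    open ≡-Reasoning
    M = m * q
    1≤m : 1 ≤ m
    1≤m = ℕₚ.<⇒≤ 2≤m
    1≤q : 1 ≤ q
    1≤q = prime-positive q-prime
    instance
      q≢0 : NonZero q
      q≢0 = >-nonZero 1≤q
      m≢0 : NonZero m
      m≢0 = >-nonZero 1≤m
      M≢0 : NonZero M
      M≢0 = >-nonZero (ℕₚ.*-mono-≤ 1≤m 1≤q)
    q∤m : q ∤ m
    q∤m = >⇒∤ 1≤m (ℕₚ.≤-<-trans (ℕₚ.m≤n+m m (d + d)) big)
    d+d<q : d + d < q
    d+d<q = ℕₚ.≤-<-trans (ℕₚ.m≤m+n (d + d) m) big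
    d<q : d < q
    d<q = ℕₚ.≤-<-trans (ℕₚ.m≤m+n d d) d+d<q
    2≤M : 2 ≤ M
    2≤M = ℕₚ.≤-trans 2≤m (ℕₚ.m≤m*n m q)
    1≤M : 1 ≤ M
    1≤M = ℕₚ.<⇒≤ 2≤M
    q≤M : q ≤ M
    q≤M = ℕₚ.m≤n*m q m
    φM1 : φ M 1 ≡ -1ℤ
    φM1 = trans (φ-1 m q-prime 2≤m q∤m) (cong ℤ.-_ φm1)
    φM1≢0 : φ M 1 ≢ 0ℤ
    φM1≢0 z with trans (sym φM1) z
    ... | ()
    vanish : VanishesFrom (suc d) (φ m)
    vanish k l = coeff-vanishes (Φ m) k (ℕₚ.≤-trans (ℕₚ.≤-reflexive len) l)
    -- From Φ_mq·Φ_m = Φ_m(x^q): the reciprocal of Φ_mq is Φ_m(x) times 1/Φ_m taken at x^q.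
    cM≈ : c M ≈ φ m ⊙ sub q (c m)
    cM≈ = ⊙-cancelʳ (φ M) (φ-isUnit M 1≤M) (≈-trans (≈-trans (⊙-comm (c M) (φ M)) (φ⊙c M 1≤M)) (≈-sym
      (≈-trans (solve 3 (λ f s g → (f :* s) :* g := (g :* f) :* s) ≈-refl (φ m) (sub q (c m)) (φ M))
      (≈-trans (⊙-cong (φ-prime-∤ m q-prime 1≤m q∤m) ≈-refl)
      (≈-trans (≈-sym (sub-⊙ q (φ m) (c m))) (≈-trans (sub-cong q (φ⊙c m 1≤m)) (sub-𝟙 q)))))))
    cM-block : ∀ i l → l < q → c M (i * q + l) ≡ φ m l ℤ.* c m i
    cM-block i l l<q = trans (at cM≈ (i * q + l)) (⊙-sub-coeff q (φ m) (c m) i l (λ k q≤k → vanish k (ℕₚ.≤-trans d<q q≤k)) l<q)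
    -- Two coefficients of Φ_m are known to be 1. The constant one serves when r > d, the leading
    -- one when 0 < r ≤ d, as then d < d + r ≤ 2d < q.
    offset : ∀ r → r < q → r ≢ 0 → ∃ λ l → l ≤ d × φ m l ≡ 1ℤ × d < l + r × l + r < q
    offset r r<q r≢0 with d <? r
    ... | yes d<r = 0 , z≤n , φ-0 m 2≤m , d<r , r<q
    ... | no d≮r = d , ℕₚ.≤-refl , lead , ℕₚ.m<m+n d (ℕₚ.n≢0⇒n>0 r≢0) ,
            ℕₚ.≤-<-trans (ℕₚ.+-monoʳ-≤ d (ℕₚ.≮⇒≥ d≮r)) d+d<q
    finish : ∀ {P r p} ps → M ≤ P → InCluster M P r p → All (InCluster M P r) ps → All (p >_) ps → AllPairs _>_ ps →
      ∀ l → l ≤ d → φ m l ≡ 1ℤ → d < l + p % q → l + p % q < q →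
      ∃₂ λ n k → 1 ≤ n × φ (m * n) k ≡ 0ℤ ℤ.- (+ length ps) ℤ.* c m ε
    finish {P} {r} {p} ps M≤P (p-prime , P<p , p≤ , p%M≡r) h gs g l l≤d φml d<l+r l+r<q = conclude
      (Cluster.cluster-coeff M P 2≤M M≤P φM1 ps k (c m ε) k<L (All.map (λ (pr , P<p , _) → pr , P<p) h) g differences)
      where
      i = ε * q + l
      i<M : i < M
      i<M = ℕₚ.<-≤-trans (ℕₚ.+-mono-≤-< (ℕₚ.*-monoˡ-≤ q ε≤1) (ℕₚ.≤-<-trans l≤d d<q))
        (ℕₚ.≤-trans (ℕₚ.≤-reflexive (cong (_+ q) (ℕₚ.*-identityˡ q))) (ℕₚ.≤-trans (ℕₚ.≤-reflexive (cong (_+_ q) (sym (ℕₚ.*-identityˡ q)))) (ℕₚ.*-monoˡ-≤ q 2≤m)))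
      -- Thus k = p + i - M. Subtracting M keeps k below p ≤ 2P, and k - p′ stays nonnegative and
      -- congruent to i because p - p′ is a positive multiple of M.
      w = M ∸ i
      i+w≡M : i + w ≡ M
      i+w≡M = ℕₚ.m+[n∸m]≡n (ℕₚ.<⇒≤ i<M)
      k = p ∸ w
      k+w≡p : k + w ≡ p
      k+w≡p = ℕₚ.m∸n+n≡m (ℕₚ.≤-trans (ℕₚ.m∸n≤m M i) (ℕₚ.≤-trans M≤P (ℕₚ.<⇒≤ P<p)))
      k<L : k < P + P
      k<L = ℕₚ.<-≤-trans (ℕₚ.<-≤-trans (ℕₚ.m<m+n k (ℕₚ.m<n⇒0<n∸m i<M)) (ℕₚ.≤-reflexive k+w≡p)) p≤
      difference : ∀ {p′} → p′ < p → p′ % M ≡ r → ∃ λ j → k ≡ p′ + j × c M j ≡ c m ε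
      difference {p′} p′<p p′%M≡r with congruent⇒difference M (trans p%M≡r (sym p′%M≡r)) p′<p
      ... | s , p≡ = s * M + i , ℕₚ.+-cancelʳ-≡ w k (p′ + (s * M + i)) (begin
          k + w                          ≡⟨ k+w≡p ⟩
          p                              ≡⟨ p≡ ⟩
          suc s * M + p′                 ≡⟨ cong (λ x → x + s * M + p′) i+w≡M ⟨
          i + w + s * M + p′             ≡⟨ regroup i w (s * M) p′ ⟩
          p′ + (s * M + i) + w           ∎) ,
        trans (c-periodic* M 1≤M φM1≢0 s i) (trans (cM-block ε l (ℕₚ.≤-<-trans l≤d d<q))
          (trans (cong (ℤ._* c m ε) φml) (ℤₚ.*-identityˡ _)))
        where
        regroup : ∀ i w x p → i + w + x + p ≡ p + (x + i) + w
        regroup = solveℕ-∀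
      differences : All (λ p′ → ∃ λ j → k ≡ p′ + j × c M j ≡ c m ε) ps
      differences = All.zipWith (λ ((_ , _ , _ , e) , l) → difference l e) (h , gs)
      i+p≡ : M + k ≡ (ε + p / q) * q + (l + p % q)
      i+p≡ = begin
        M + k                                   ≡⟨ cong (_+ k) i+w≡M ⟨
        i + w + k                               ≡⟨ trans (ℕₚ.+-assoc i w k) (cong (_+_ i) (trans (ℕₚ.+-comm w k) k+w≡p)) ⟩
        i + p                                   ≡⟨ cong (_+_ i) (m≡m%n+[m/n]*n p q) ⟩
        ε * q + l + (p % q + p / q * q)         ≡⟨ regroup ε q l (p % q) (p / q) ⟩
        (ε + p / q) * q + (l + p % q)           ∎
        where
        regroup : ∀ ε q l r x → ε * q + l + (r + x * q) ≡ (ε + x) * q + (l + r)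
        regroup = solveℕ-∀
      cMk≡0 : c M k ≡ 0ℤ
      cMk≡0 = begin
        c M k                                       ≡⟨ c-periodic M 1≤M φM1≢0 k ⟨
        c M (M + k)                                 ≡⟨ cong (c M) i+p≡ ⟩
        c M ((ε + p / q) * q + (l + p % q))         ≡⟨ cM-block (ε + p / q) (l + p % q) l+r<q ⟩
        φ m (l + p % q) ℤ.* c m (ε + p / q)         ≡⟨ cong (ℤ._* c m (ε + p / q)) (vanish (l + p % q) d<l+r) ⟩
        0ℤ ℤ.* c m (ε + p / q)                      ≡⟨ ℤₚ.*-zeroˡ (c m (ε + p / q)) ⟩
        0ℤ                                          ∎
      conclude : (∃ λ n → 1 ≤ n × φ (M * n) k ≡ c M k ℤ.- (+ length ps) ℤ.* c m ε) →
        ∃₂ λ n k → 1 ≤ n × φ (m * n) k ≡ 0ℤ ℤ.- (+ length ps) ℤ.* c m ε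
      conclude (n , 1≤n , e) = q * n , k , ℕₚ.*-mono-≤ 1≤q 1≤n ,
        trans (cong (λ N → φ N k) (sym (ℕₚ.*-assoc m q n))) (trans e (cong (ℤ._- (+ length ps) ℤ.* c m ε) cMk≡0))
    result : ∃₂ λ n k → 1 ≤ n × φ (m * n) k ≡ 0ℤ ℤ.- (+ t) ℤ.* c m ε
    result with prime-cluster M t M
    ... | P , r , p , ps , M≤P , refl , hp@(p-prime , P<p , _) ∷ h , gs ∷ g
      with offset (p % q) (m%n<n p q) p%q≢0
      where
      p%q≢0 : p % q ≢ 0
      p%q≢0 z with prime⇒irreducible p-prime (m%n≡0⇒n∣m p q z)
      ... | inj₁ q≡1 = ¬prime[1] (subst Prime q≡1 q-prime)
      ... | inj₂ q≡p = ℕₚ.<⇒≢ (ℕₚ.≤-<-trans (ℕₚ.≤-trans q≤M M≤P) P<p) q≡p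
    ...   | l , l≤d , φml , d<l+r , l+r<q = finish ps M≤P hp h gs g l l≤d φml d<l+r l+r<q

  -- The coefficient obtained is -t·c(m,ε), where c(m,0) = 1 and c(m,1) = -a(m,1) = -1; the two
  -- values of ε supply the two signs.
  realise : ∀ z → ∃₂ λ n k → 1 ≤ n × φ (m * n) k ≡ z
  realise (+ t) with realise-multiple t 1 ℕₚ.≤-refl
  ... | n , k , 1≤n , e = n , k , 1≤n , trans e (trans (cong (λ x → 0ℤ ℤ.- (+ t) ℤ.* x) c1) (simplify (+ t)))
    where
    c1 : c m 1 ≡ -1ℤ
    c1 = cong₂ (λ x y → x ℤ.* ℤ.- (y ℤ.* x ℤ.+ 0ℤ)) (φ-0 m 2≤m) φm1
    simplify : ∀ x → 0ℤ ℤ.+ ℤ.- (x ℤ.* -1ℤ) ≡ x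
    simplify = solve-∀
  realise (ℤ.-[1+ t ]) with realise-multiple (suc t) 0 z≤n
  ... | n , k , 1≤n , e = n , k , 1≤n , trans e (trans (cong (λ x → 0ℤ ℤ.- (+ suc t) ℤ.* x) (φ-0 m 2≤m)) (simplify (+ suc t)))
    where
    simplify : ∀ x → 0ℤ ℤ.+ ℤ.- (x ℤ.* 1ℤ) ≡ ℤ.- x
    simplify = solve-∀

-- r is the squarefree kernel of m.
record Reduction (m : ℕ) : Set where
  field
    r     : ℕ
    2≤r   : 2 ≤ r
    r∣m   : r ∣ m
    φr1   : φ r 1 ≡ 1ℤ ⊎ φ r 1 ≡ -1ℤ
    embed : ∀ n k → 1 ≤ n → ∃ λ k′ → φ (m * n) k′ ≡ φ (r * n) k

-- If p ∣ r ∣ m, then Φ_mnp(x) = Φ_mn(x^p), and every coefficient of Φ_mn reappears at p times its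
-- index. Otherwise p joins the kernel, and the earlier embedding is applied with pn in place of n.
reduction-step : ∀ {m p} → 1 ≤ m → Prime p → Reduction m → Reduction (m * p)
reduction-step {m} {p} 1≤m pr R with p ∣? Reduction.r R
... | yes p∣r = record
  { Reduction R
  ; r∣m   = ∣m⇒∣m*n p r∣m
  ; embed = λ n k 1≤n → step n 1≤n (embed n k 1≤n)
  }
  where
  open Reduction R
  swap : ∀ m n p → m * p * n ≡ m * n * p
  swap = solveℕ-∀
  step : ∀ n {x} → 1 ≤ n → (∃ λ k → φ (m * n) k ≡ x) → ∃ λ k → φ (m * p * n) k ≡ x
  step n 1≤n (k , e) = k * p , trans (cong (λ N → φ N (k * p)) (swap m n p))
    (trans (at (φ-prime-∣ (m * n) pr (ℕₚ.*-mono-≤ 1≤m 1≤n) (∣m⇒∣m*n n (∣-trans p∣r r∣m))) (k * p))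
      (trans (sub-coeff p (φ (m * n)) k (prime-positive pr)) e))
... | no p∤r = record
  { r     = r * p
  ; 2≤r   = ℕₚ.≤-trans 2≤r (ℕₚ.m≤m*n r p {{prime⇒nonZero pr}})
  ; r∣m   = *-monoˡ-∣ p r∣m
  ; φr1   = flip φr1
  ; embed = λ n k 1≤n → step n k (embed (p * n) k (ℕₚ.*-mono-≤ (prime-positive pr) 1≤n))
  }
  where
  open Reduction R
  flip : φ r 1 ≡ 1ℤ ⊎ φ r 1 ≡ -1ℤ → φ (r * p) 1 ≡ 1ℤ ⊎ φ (r * p) 1 ≡ -1ℤ
  flip (inj₁ e) = inj₂ (trans (φ-1 r pr 2≤r p∤r) (cong ℤ.-_ e))
  flip (inj₂ e) = inj₁ (trans (φ-1 r pr 2≤r p∤r) (cong ℤ.-_ e))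
  step : ∀ n k → (∃ λ k′ → φ (m * (p * n)) k′ ≡ φ (r * (p * n)) k) → ∃ λ k′ → φ (m * p * n) k′ ≡ φ (r * p * n) k
  step n k (k′ , e) = k′ , trans (cong (λ N → φ N k′) (ℕₚ.*-assoc m p n))
    (trans e (cong (λ N → φ N k) (sym (ℕₚ.*-assoc r p n))))

-- The extra factor 2 provides the start r = 2 with a(2,1) = 1, so that r ≥ 2 even for the empty
-- list; multiples of 2m are multiples of m.
reduction : ∀ ps → All Prime ps → 1 ≤ 2 * product ps × Reduction (2 * product ps)
reduction [] [] = s≤s z≤n , record
  { r = 2 ; 2≤r = ℕₚ.≤-refl ; r∣m = ∣-refl ; φr1 = inj₁ refl ; embed = λ n k _ → k , refl }
reduction (p ∷ ps) (pr ∷ prs) with reduction ps prs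
... | 1≤m , R = subst (λ m → 1 ≤ m × Reduction m) (rearrange (product ps) p)
  (ℕₚ.*-mono-≤ 1≤m (prime-positive pr) , reduction-step 1≤m pr R)
  where
  rearrange : ∀ x p → 2 * x * p ≡ 2 * (p * x)
  rearrange = solveℕ-∀

coefficients : ∀ m → 1 ≤ m → ∀ z → ∃₂ λ n k → 1 ≤ n × φ (2 * m * n) k ≡ z
coefficients m 1≤m z with factorise m {{>-nonZero 1≤m}}
... | record { factors = ps ; isFactorisation = refl ; factorsPrime = prs } = choose φr1
  where
  open Reduction (proj₂ (reduction ps prs))
  transport : (∃₂ λ n k → 1 ≤ n × φ (r * n) k ≡ z) → ∃₂ λ n k → 1 ≤ n × φ (2 * m * n) k ≡ z
  transport (n , k , 1≤n , e) with embed n k 1≤n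
  ... | k′ , e′ = n , k′ , 1≤n , trans e′ e
  choose : φ r 1 ≡ 1ℤ ⊎ φ r 1 ≡ -1ℤ → ∃₂ λ n k → 1 ≤ n × φ (2 * m * n) k ≡ z
  choose (inj₁ e) = transport (realise r 2≤r e z)
  -- A further prime flips the sign of a(r,1).
  choose (inj₂ e) with prime-above r
  ... | q , pr , r<q with realise (r * q) (ℕₚ.≤-trans 2≤r (ℕₚ.m≤m*n r q {{prime⇒nonZero pr}}))
                            (trans (φ-1 r pr 2≤r (>⇒∤ (ℕₚ.<⇒≤ 2≤r) r<q)) (cong ℤ.-_ e)) z
  ...   | n , k , 1≤n , e′ = transport (q * n , k , ℕₚ.*-mono-≤ (prime-positive pr) 1≤n ,
            trans (cong (λ N → φ N k) (sym (ℕₚ.*-assoc r q n))) e′)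

theorem1 : (m : ℕ) → m ≥ 1 → (z : ℤ) →
    (Σ ℕ (λ n → Σ ℕ (λ k → n ≥ 1 × a (m * n) k ≡ z)))
    × (Σ ℕ (λ n → Σ ℕ (λ k → n ≥ 1 × c (m * n) k ≡ z)))
theorem1 m m≥1 z with coefficients m m≥1 z
... | n , k , 1≤n , e with prime-above (2 * m * n + k)
...   | q , pr , big =
  (2 * n , k , ℕₚ.*-mono-≤ (s≤s {0} {1} z≤n) 1≤n , trans (cong (λ N → a N k) (swap m n)) e) ,
  (2 * n * q , k , ℕₚ.*-mono-≤ (ℕₚ.*-mono-≤ (s≤s {0} {1} z≤n) 1≤n) (prime-positive pr) ,
    trans (cong (λ N → c N k) (swap-* m n q)) (trans (c≡a N 2≤N pr q∤N k k<q) e))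
  where
  N = 2 * m * n
  swap : ∀ m n → m * (2 * n) ≡ 2 * m * n
  swap = solveℕ-∀
  swap-* : ∀ m n q → m * (2 * n * q) ≡ 2 * m * n * q
  swap-* = solveℕ-∀
  2≤N : 2 ≤ N
  2≤N = ℕₚ.*-mono-≤ (ℕₚ.*-mono-≤ (ℕₚ.≤-refl {2}) m≥1) 1≤n
  q∤N : q ∤ N
  q∤N = >⇒∤ (ℕₚ.<⇒≤ 2≤N) (ℕₚ.≤-<-trans (ℕₚ.m≤m+n N k) big)
  k<q : k < q
  k<q = ℕₚ.≤-<-trans (ℕₚ.m≤n+m k N) big
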